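{- Let $\lambda=(\lambda_1,\dots,\lambda_m)$ be a non-increasing sequence of positive integers with $m\ge 1$. Define $d_i=\lambda_i-\lambda_{i+1}$ for $1\le i<m$, $d_m=\lambda_m$, $\widetilde{d}_i=\lambda_{i-1}-\lambda_i$ for $1<i\le m$, and $\widetilde{d}_1=\infty$. Then $$|S_1(\lambda_1,\dots,\lambda_m)|=\sum_E|S_0(\lambda_1+\epsilon_1,\dots,\lambda_m+\epsilon_m)|,$$ where the sum runs over all tuples $E=(\epsilon_1,\dots,\epsilon_m)$ with each $\epsilon_i\in\{0,\pm1\}$, such that $\epsilon_i=-1$ for exactly one index $i=i_1$, which satisfies $i_1>1$ and $d_{i_1}>0$, and $\epsilon_i=1$ for exactly one index $i=i_2$, which satisfies $i_2<i_1$ and $\widetilde{d}_{i_2}>0$ (all other $\epsilon_i=0$).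
   Context: For a shape $\mu=(\mu_1,\dots,\mu_k)$ (non-increasing, rows of length zero omitted) with $N=\sum\mu_i$ boxes, a tableau of shape $\mu$ is a bijective filling of the left-justified Young diagram with $1,\dots,N$; it is row-standard if entries increase left to right along each row. For a row-standard tableau $\tau$, a pair of entries $i<j$ in the same column is an inversion if either (1) $i$ or $j$ has no entry immediately to its right and $i$ lies below $j$, or (2) $i$ is immediately followed on its right by $i'$, $j$ is immediately followed on its right by $j'$, and $i'>j'$. $S_i(\mu)$ is the set of row-standard tableaux of shape $\mu$ with exactly $i$ inversions; $S_0(\mu)$ is the set of standard Young tableaux of shape $\mu$. -}

module Defs where

open import Data.Nat using (ℕ; zero; suc; _+_; _∸_; _≤_; _<_; _≥_; _≟_; _<?_; _≤?_)
open import Data.Nat.Properties using ()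
open import Data.Bool using (Bool; true; false; if_then_else_)
open import Data.Maybe using (Maybe; just; nothing)
open import Data.List using (List; []; _∷_; length; map; upTo; concat)
open import Data.Nat.ListAction using (sum)
open import Data.List.Relation.Unary.All using (All)
open import Data.List.Relation.Unary.Linked using (Linked)
open import Data.List.Relation.Unary.Unique.Propositional using (Unique)
open import Data.List.Membership.Propositional using (_∈_)
open import Data.List.Relation.Binary.Permutation.Propositional using (_↭_)
open import Data.Product using (Σ; _×_; _,_)
open import Data.Sum using (_⊎_)
open import Relation.Nullary using (Dec; does)
open import Relation.Nullary.Decidable using (_×-dec_; _⊎-dec_)
open import Relation.Binary.PropositionalEquality using (_≡_)

-- A shape is a list of row lengths (top row first).
Shape : Set
Shape = List ℕ

-- A filling of a left-justified diagram: a list of rows (top row first),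
-- each row a list of entries from left to right.
Tab : Set
Tab = List (List ℕ)

oneTo : ℕ → List ℕ
oneTo N = map suc (upTo N)

IsTableau : Shape → Tab → Set
IsTableau μ T = (map length T ≡ μ) × (concat T ↭ oneTo (sum μ))

RowStandard : Tab → Set
RowStandard T = All (Linked _<_) T

_!?_ : {A : Set} → List A → ℕ → Maybe A
[]       !? _     = nothing
(x ∷ xs) !? zero  = just x
(x ∷ xs) !? suc n = xs !? n

cell : Tab → ℕ → ℕ → Maybe ℕ
cell T r c with T !? r
... | nothing  = nothing
... | just row = row !? c

b2n : Bool → ℕ
b2n true  = 1
b2n false = 0

-- Given an upper cell with entry t and right neighbour tr (if any) and a
-- lower cell (same column) with entry b and right neighbour br, returns 1
-- iff the pair {t, b} is an inversion (with i = min, j = max).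
pairInv : ℕ → Maybe ℕ → ℕ → Maybe ℕ → ℕ
pairInv t tr b br with does (t <? b)
-- i = t (upper), j = b (lower): condition (1) fails since i is above j
... | true with tr | br
...   | just t' | just b' = b2n (does (b' <? t'))
...   | _       | _       = 0
-- i = b (lower), j = t (upper)
pairInv t tr b br | false with br | tr
...   | just b' | just t' = b2n (does (t' <? b'))
...   | _       | _       = 1

invAt : Tab → ℕ → ℕ → ℕ → ℕ
invAt T r r' c with cell T r c | cell T r' c
... | just t | just b = pairInv t (cell T r (suc c)) b (cell T r' (suc c))
... | _      | _      = 0

inversions : Tab → ℕ
inversions T =
  sum (map (λ r' → sum (map (λ r →
    sum (map (λ c → invAt T r r' c) (upTo (length (concat T)))))
    (upTo r'))) (upTo (length T)))

S : ℕ → Shape → Tab → Set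
S i μ T = IsTableau μ T × RowStandard T × (inversions T ≡ i)

HasCard : (Tab → Set) → ℕ → Set
HasCard P n = Σ (List Tab) λ xs →
  Unique xs × All P xs × (∀ T → P T → T ∈ xs) × (length xs ≡ n)

-- Data of the theorem (1-indexed as in the paper)

-- λ_i for 1 ≤ i ≤ m, and 0 otherwise (in particular λ_{m+1} = 0)
lam : List ℕ → ℕ → ℕ
lam λs zero    = 0
lam λs (suc i) with λs !? i
... | just x  = x
... | nothing = 0

-- d_i = λ_i - λ_{i+1} (i < m), d_m = λ_m
d : List ℕ → ℕ → ℕ
d λs i = lam λs i ∸ lam λs (suc i)

dt : List ℕ → ℕ → ℕ
dt λs i = lam λs (i ∸ 1) ∸ lam λs i

-- d̃_i > 0, with d̃_1 = ∞
dtPos : List ℕ → ℕ → Set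
dtPos λs i = (i ≡ 1) ⊎ (0 < dt λs i)

ValidE : List ℕ → ℕ → ℕ → Set
ValidE λs i₁ i₂ =
  (1 ≤ i₂) × (i₂ < i₁) × (i₁ ≤ length λs) × (0 < d λs i₁) × dtPos λs i₂

validE? : ∀ λs i₁ i₂ → Dec (ValidE λs i₁ i₂)
validE? λs i₁ i₂ =
  (1 ≤? i₂) ×-dec (suc i₂ ≤? i₁) ×-dec (i₁ ≤? length λs)
  ×-dec (1 ≤? d λs i₁) ×-dec ((i₂ ≟ 1) ⊎-dec (1 ≤? dt λs i₂))

dropZeros : List ℕ → List ℕ
dropZeros []            = []
dropZeros (zero  ∷ xs)  = dropZeros xs
dropZeros (suc x ∷ xs)  = suc x ∷ dropZeros xs

-- (λ_1 + ε_1, ..., λ_m + ε_m) where ε_{i₁} = -1, ε_{i₂} = +1, others 0;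
-- k is the 1-based index of the head of the list
addEAt : ℕ → ℕ → ℕ → List ℕ → List ℕ
addEAt i₁ i₂ k []       = []
addEAt i₁ i₂ k (x ∷ xs) =
  (if does (k ≟ i₁) then x ∸ 1 else (if does (k ≟ i₂) then suc x else x))
  ∷ addEAt i₁ i₂ (suc k) xs

shapeE : List ℕ → ℕ → ℕ → Shape
shapeE λs i₁ i₂ = dropZeros (addEAt i₁ i₂ 1 λs)

-- Σ_E f(E), E ↔ admissible (i₁, i₂), summed over 1 ≤ i₂ < i₁ ≤ m
sumE : List ℕ → (ℕ → ℕ → ℕ) → ℕ
sumE λs f =
  sum (map (λ i₁ → sum (map (λ i₂ →
    if does (validE? λs i₁ i₂) then f i₁ i₂ else 0)
    (upTo i₁))) (upTo (suc (length λs))))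

{-# OPTIONS --safe #-}
module Submission where

-- Let N be the largest entry. It ends its row j. If row j + 1 is shorter, deleting N does not change the
-- number of inversions; if row j + 1 has the same length, exchanging the two rows lowers that number by
-- exactly one. Hence, with λ_j > λ_{j+1} abbreviated "j is a corner",
--   |S₀(λ)| = Σ_j |S₀(λ - e_j)|                          (j a corner),
--   |S₁(λ)| = Σ_j |S₁(λ - e_j)| + Σ_j |S₀(λ - e_j)|      (j a corner, with λ_{j-1} = λ_j in the second sum).
-- The right-hand side of the theorem satisfies the second recursion: modulo the terms of the second sum,
-- removing a box commutes with moving a box to a higher row.

-- If row j + 1 is as long as row j, the exchange puts N into row j + 1 and leaves one inversion
-- fewer. Hence a filling without inversions has N at a corner, and a filling with one inversion and
-- N in such a row j comes from one without inversions and with N in row j + 1, which is then a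
-- corner. This contribution belongs to row j + 1, and that is the row called j in the second sum.
-- The two orders of moving and removing differ only in how often they reach λ - e_b for a corner b.
-- Moving first does so once for each row a < b that can be lengthened: the box goes from b to a and
-- is then removed from a. Removing first does so once for each corner c < b: the box removed from c
-- is replaced by the one from b. Row 1 can always be lengthened, a row a > 1 iff a - 1 is a corner.
-- So for b > 1 the two counts differ by one exactly if b - 1 is not a corner, that is, if λ_{b-1} =
-- λ_b.

open import Defs
open import Data.Bool using (true; false; if_then_else_)
open import Data.List using (List; []; _∷_; length; map; concat; _++_; _∷ʳ_; [_]; upTo)
open import Data.List.Membership.Propositional using (_∈_; _∉_)
open import Data.List.Membership.Propositional.Properties
  using (∈-++⁺ˡ; ∈-++⁺ʳ; ∈-++⁻; ∈-map⁺; ∈-upTo⁻)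
open import Data.List.Membership.Propositional.Properties.WithK using (unique∧set⇒bag)
open import Data.List.Properties
  using (length-++; length-map; map-++; map-applyUpTo; map-upTo; upTo-∷ʳ; ∷-injective; ∷ʳ-injective)
open import Data.List.Relation.Binary.BagAndSetEquality using (∼bag⇒↭)
open import Data.List.Relation.Binary.Permutation.Propositional
  using (_↭_; ↭-refl; ↭-sym; ↭-trans; ↭-prep; ↭-swap; ↭-reflexive; ↭⇒↭ₛ)
open import Data.List.Relation.Binary.Permutation.Propositional.Properties
  using (++⁺ˡ; ++⁺ʳ; shift; shifts; drop-∷; ∷↭∷ʳ; ↭-length; All-resp-↭; ∈-resp-↭)
import Data.List.Relation.Binary.Permutation.Setoid.Properties as ↭ₛ
open import Data.List.Relation.Unary.All as All using (All; []; _∷_)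
import Data.List.Relation.Unary.All.Properties as All
open import Data.List.Relation.Unary.AllPairs using ([]; _∷_)
open import Data.List.Relation.Unary.Any using (here; there)
open import Data.List.Relation.Unary.Linked using (Linked; []; [-]; _∷_)
open import Data.List.Relation.Unary.Unique.Propositional using (Unique)
import Data.List.Relation.Unary.Unique.Propositional.Properties as Unique
open import Data.Maybe using (Maybe; just; nothing)
open import Data.Nat
open import Data.Nat.ListAction using (sum)
open import Data.Nat.Properties
open import Data.Nat.Tactic.RingSolver using (solve-∀)
open import Data.Product using (_×_; _,_; ∃; ∃₂; proj₁; proj₂)
open import Data.Sum using (_⊎_; inj₁; inj₂)
open import Function using (_∘_; mk⇔)
open import Relation.Binary.Definitions using (tri<; tri≈; tri>)
open import Relation.Binary.PropositionalEquality hiding ([_])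
open import Relation.Nullary using (Dec; yes; no; does; ¬_; contradiction)
open import Relation.Nullary.Decidable using (dec-true; dec-false)

-- Sums over boxes of a shape

guard : {A : Set} → Dec A → ℕ → ℕ
guard d n = if does d then n else 0

module _ {A : Set} where

  guard-yes : (d : Dec A) {n : ℕ} → A → guard d n ≡ n
  guard-yes (yes _) _ = refl
  guard-yes (no ¬a) a = contradiction a ¬a

  guard-no : (d : Dec A) {n : ℕ} → ¬ A → guard d n ≡ 0
  guard-no (yes a) ¬a = contradiction a ¬a
  guard-no (no _)  _  = refl

  guard-0 : (d : Dec A) → guard d 0 ≡ 0
  guard-0 (yes _) = refl
  guard-0 (no _)  = refl

  guard-+ : (d : Dec A) (m n : ℕ) → guard d (m + n) ≡ guard d m + guard d n
  guard-+ (yes _) m n = refl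
  guard-+ (no _)  m n = refl

  guard-cong : (d : Dec A) {m n : ℕ} → (A → m ≡ n) → guard d m ≡ guard d n
  guard-cong (yes a) eq = eq a
  guard-cong (no _)  eq = refl

module _ {A B : Set} where

  guard-⇔ : (d : Dec A) (e : Dec B) {n : ℕ} → (A → B) → (B → A) → guard d n ≡ guard e n
  guard-⇔ (yes a) e f g = sym (guard-yes e (f a))
  guard-⇔ (no ¬a) e f g = sym (guard-no e (¬a ∘ g))

  guard-comm : (d : Dec A) (e : Dec B) (n : ℕ) → guard d (guard e n) ≡ guard e (guard d n)
  guard-comm (yes _) e n = refl
  guard-comm (no _)  e n = sym (guard-0 e)

guard-× : {A B C : Set} (c : Dec C) (a : Dec A) (b : Dec B) {n : ℕ} →
  (C → A) → (C → B) → (A → B → C) → guard c n ≡ guard a (guard b n)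
guard-× (yes c) a b f g h = sym (trans (guard-yes a (f c)) (guard-yes b (g c)))
guard-× (no ¬c) (no _) b f g h = refl
guard-× (no ¬c) (yes a) b f g h = sym (guard-no b (¬c ∘ h a))

∑ : ℕ → (ℕ → ℕ) → ℕ
∑ zero    f = 0
∑ (suc n) f = f 0 + ∑ n (f ∘ suc)

∑-upTo : ∀ n f → sum (map f (upTo n)) ≡ ∑ n f
∑-upTo zero    f = refl
∑-upTo (suc n) f = cong (f 0 +_)
  (trans (cong sum (trans (map-applyUpTo suc f n) (sym (map-upTo (f ∘ suc) n)))) (∑-upTo n (f ∘ suc)))

∑-cong : ∀ n {f g} → (∀ i → i < n → f i ≡ g i) → ∑ n f ≡ ∑ n g
∑-cong zero    eq = refl
∑-cong (suc n) eq = cong₂ _+_ (eq 0 z<s) (∑-cong n (λ i i<n → eq (suc i) (s<s i<n)))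

∑-0 : ∀ n → ∑ n (λ _ → 0) ≡ 0
∑-0 zero    = refl
∑-0 (suc n) = ∑-0 n

+-interchange : ∀ a b c d → (a + b) + (c + d) ≡ (a + c) + (b + d)
+-interchange = solve-∀

∑-+ : ∀ n f g → ∑ n (λ i → f i + g i) ≡ ∑ n f + ∑ n g
∑-+ zero    f g = refl
∑-+ (suc n) f g = trans (cong (f 0 + g 0 +_) (∑-+ n (f ∘ suc) (g ∘ suc))) (+-interchange (f 0) _ _ _)

∑-guard : {A : Set} (d : Dec A) → ∀ n f → ∑ n (λ i → guard d (f i)) ≡ guard d (∑ n f)
∑-guard (yes _) n f = refl
∑-guard (no _)  n f = ∑-0 n

-- Pairs `r < s < n` are grouped by the smaller index, so that the recursion follows a list of rows
-- from its head; the sums over `upTo` in the definitions group them by the larger one.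
∑△ : ℕ → (ℕ → ℕ → ℕ) → ℕ
∑△ zero    h = 0
∑△ (suc n) h = ∑ n (λ s → h 0 (suc s)) + ∑△ n (λ r s → h (suc r) (suc s))

∑△-correct : ∀ n h → ∑ n (λ s → ∑ s (λ r → h r s)) ≡ ∑△ n h
∑△-correct zero    h = refl
∑△-correct (suc n) h = trans
  (∑-+ n (λ s → h 0 (suc s)) (λ s → ∑ s (λ r → h (suc r) (suc s))))
  (cong (∑ n (λ s → h 0 (suc s)) +_) (∑△-correct n (λ r s → h (suc r) (suc s))))

∑△-cong : ∀ n {h k} → (∀ r s → r < s → s < n → h r s ≡ k r s) → ∑△ n h ≡ ∑△ n k
∑△-cong zero    eq = refl
∑△-cong (suc n) eq = cong₂ _+_
  (∑-cong n (λ s s<n → eq 0 (suc s) z<s (s<s s<n)))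
  (∑△-cong n (λ r s r<s s<n → eq (suc r) (suc s) (s<s r<s) (s<s s<n)))

-- Zero beyond the last row, matching the convention λ_{m+1} = 0.
part : List ℕ → ℕ → ℕ
part []       _       = 0
part (y ∷ ys) zero    = y
part (y ∷ ys) (suc i) = part ys i

infixr 5 _∷_
-- Zero parts are allowed: a row that loses its last box stays in the list, so that removing a box
-- never renumbers the rows.
data Partition : List ℕ → Set where
  []  : Partition []
  _∷_ : ∀ {y ys} → part ys 0 ≤ y → Partition ys → Partition (y ∷ ys)

decAt : ℕ → List ℕ → List ℕ
decAt _       []       = []
decAt zero    (y ∷ ys) = pred y ∷ ys
decAt (suc i) (y ∷ ys) = y ∷ decAt i ys

incAt : ℕ → List ℕ → List ℕ
incAt _       []       = []
incAt zero    (y ∷ ys) = suc y ∷ ys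
incAt (suc i) (y ∷ ys) = y ∷ incAt i ys

corner? : ∀ μ j → Dec (part μ (suc j) < part μ j)
corner? μ j = part μ (suc j) <? part μ j

-- The row above row j of μ is row j of x ∷ μ, so that x plays the role of λ₀ (any x > λ₁ stands for ∞).
addable? : ∀ x μ j → Dec (part μ j < part (x ∷ μ) j)
addable? x μ j = part μ j <? part (x ∷ μ) j

removeSum : (List ℕ → ℕ) → List ℕ → ℕ
removeSum g μ = ∑ (length μ) λ j → guard (corner? μ j) (g (decAt j μ))

-- Both conditions can be tested on `μ` itself: since `a < b`, lengthening row `a` leaves rows `b`
-- and `b + 1` as they are.
moveSum : ℕ → (List ℕ → ℕ) → List ℕ → ℕ
moveSum x g μ = ∑△ (length μ) λ a b →
  guard (addable? x μ a) (guard (corner? μ b) (g (decAt b (incAt a μ))))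

repeatedTerm : ℕ → (List ℕ → ℕ) → List ℕ → ℕ → ℕ
repeatedTerm x g μ j = guard (part μ j ≟ part (x ∷ μ) j) (guard (corner? μ j) (g (decAt j μ)))

repeatedSum : ℕ → (List ℕ → ℕ) → List ℕ → ℕ
repeatedSum x g μ = ∑ (length μ) (repeatedTerm x g μ)

decAt-head : ∀ j μ → part (decAt j μ) 0 ≤ part μ 0
decAt-head j       []      = z≤n
decAt-head zero    (y ∷ μ) = pred[n]≤n
decAt-head (suc j) (y ∷ μ) = ≤-refl

decAt-partition : ∀ j {μ} → Partition μ → part μ (suc j) < part μ j → Partition (decAt j μ)
decAt-partition j       []        c = []
decAt-partition zero    (z≤y ∷ P) c = <⇒≤pred c ∷ P
decAt-partition (suc j) {y ∷ μ} (z≤y ∷ P) c = ≤-trans (decAt-head j μ) z≤y ∷ decAt-partition j P c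

removeSum-cong : ∀ {g h} μ →
  (∀ j → part μ (suc j) < part μ j → g (decAt j μ) ≡ h (decAt j μ)) → removeSum g μ ≡ removeSum h μ
removeSum-cong μ eq = ∑-cong (length μ) λ j _ → guard-cong (corner? μ j) (eq j)

removeSum-+ : ∀ g h μ → removeSum (λ ν → g ν + h ν) μ ≡ removeSum g μ + removeSum h μ
removeSum-+ g h μ = trans
  (∑-cong (length μ) λ j _ → guard-+ (corner? μ j) (g (decAt j μ)) (h (decAt j μ)))
  (∑-+ (length μ) _ _)

removeSum-guard : {A : Set} (d : Dec A) → ∀ g μ →
  removeSum (λ ν → guard d (g ν)) μ ≡ guard d (removeSum g μ)
removeSum-guard d g μ = trans
  (∑-cong (length μ) λ j _ → guard-comm (corner? μ j) d _)
  (∑-guard d (length μ) _)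

moveSum-∷ : ∀ x g y μ → moveSum x g (y ∷ μ) ≡
  guard (y <? x) (removeSum (g ∘ (suc y ∷_)) μ) + moveSum y (g ∘ (y ∷_)) μ
moveSum-∷ x g y μ = cong (_+ _) (∑-guard (y <? x) (length μ) _)

moveSum-cong : ∀ x {g h} μ → (∀ ν → g ν ≡ h ν) → moveSum x g μ ≡ moveSum x h μ
moveSum-cong x μ eq = ∑△-cong (length μ) λ a b _ _ →
  cong (λ n → guard (addable? x μ a) (guard (corner? μ b) n)) (eq _)

moveSum-+ : ∀ x g h μ → moveSum x (λ ν → g ν + h ν) μ ≡ moveSum x g μ + moveSum x h μ
moveSum-+ x g h []      = refl
moveSum-+ x g h (y ∷ μ) = begin
  moveSum x (λ ν → g ν + h ν) (y ∷ μ)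
    ≡⟨ moveSum-∷ x (λ ν → g ν + h ν) y μ ⟩
  guard (y <? x) (removeSum (λ ν → g (suc y ∷ ν) + h (suc y ∷ ν)) μ) + moveSum y (λ ν → g (y ∷ ν) + h (y ∷ ν)) μ
    ≡⟨ cong₂ _+_
         (trans (cong (guard (y <? x)) (removeSum-+ (g ∘ (suc y ∷_)) (h ∘ (suc y ∷_)) μ)) (guard-+ (y <? x) _ _))
         (moveSum-+ y (g ∘ (y ∷_)) (h ∘ (y ∷_)) μ) ⟩
  (guard (y <? x) (removeSum (g ∘ (suc y ∷_)) μ) + guard (y <? x) (removeSum (h ∘ (suc y ∷_)) μ))
    + (moveSum y (g ∘ (y ∷_)) μ + moveSum y (h ∘ (y ∷_)) μ)
    ≡⟨ +-interchange (guard (y <? x) (removeSum (g ∘ (suc y ∷_)) μ)) _ _ _ ⟩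
  (guard (y <? x) (removeSum (g ∘ (suc y ∷_)) μ) + moveSum y (g ∘ (y ∷_)) μ)
    + (guard (y <? x) (removeSum (h ∘ (suc y ∷_)) μ) + moveSum y (h ∘ (y ∷_)) μ)
    ≡⟨ cong₂ _+_ (moveSum-∷ x g y μ) (moveSum-∷ x h y μ) ⟨
  moveSum x g (y ∷ μ) + moveSum x h (y ∷ μ) ∎
  where open ≡-Reasoning

moveSum-0 : ∀ x μ → moveSum x (λ _ → 0) μ ≡ 0
moveSum-0 x []      = refl
moveSum-0 x (y ∷ μ) = trans (moveSum-∷ x (λ _ → 0) y μ) (cong₂ _+_
  (trans (cong (guard (y <? x)) (trans (∑-cong (length μ) (λ j _ → guard-0 (corner? μ j))) (∑-0 (length μ))))
    (guard-0 (y <? x)))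
  (moveSum-0 y μ))

-- Exchanges a move among the lower rows with shortening the row of length `y` above them. Boxes
-- only go up, so a move never shortens the first row, and it lengthens that row by at most one.
-- Ending below `y` is therefore the same as starting below `y` and obeying the bound `pred y`.
moveSum-below : ∀ y h {μ} → part μ 0 ≤ y →
  moveSum y (λ ν → guard (part ν 0 <? y) (h ν)) μ ≡ guard (part μ 0 <? y) (moveSum (pred y) h μ)
moveSum-below y h {[]} z≤y = sym (guard-0 (0 <? y))
moveSum-below y h {z ∷ μ} z≤y = trans (moveSum-∷ y k z μ) (split (z <? y))
  where
  open ≡-Reasoning
  k : List ℕ → ℕ
  k ν = guard (part ν 0 <? y) (h ν)

  split : (d : Dec (z < y)) →
    guard (z <? y) (removeSum (k ∘ (suc z ∷_)) μ) + moveSum z (k ∘ (z ∷_)) μ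
      ≡ guard d (moveSum (pred y) h (z ∷ μ))
  split (yes z<y) = begin
    guard (z <? y) (removeSum (k ∘ (suc z ∷_)) μ) + moveSum z (k ∘ (z ∷_)) μ
      ≡⟨ cong₂ _+_ (guard-yes (z <? y) z<y)
                   (moveSum-cong z {k ∘ (z ∷_)} {h ∘ (z ∷_)} μ (λ ν → guard-yes (z <? y) z<y)) ⟩
    removeSum (λ ν → guard (suc z <? y) (h (suc z ∷ ν))) μ + moveSum z (h ∘ (z ∷_)) μ
      ≡⟨ cong (_+ moveSum z (h ∘ (z ∷_)) μ) (removeSum-guard (suc z <? y) (h ∘ (suc z ∷_)) μ) ⟩
    guard (suc z <? y) (removeSum (h ∘ (suc z ∷_)) μ) + moveSum z (h ∘ (z ∷_)) μ
      ≡⟨ cong (_+ _) (guard-⇔ (suc z <? y) (z <? pred y) <⇒≤pred (λ p → <-≤-trans (s<s p) (suc-pred-≤ p))) ⟩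
    guard (z <? pred y) (removeSum (h ∘ (suc z ∷_)) μ) + moveSum z (h ∘ (z ∷_)) μ
      ≡⟨ moveSum-∷ (pred y) h z μ ⟨
    moveSum (pred y) h (z ∷ μ) ∎
    where
    suc-pred-≤ : ∀ {w y} → w < pred y → suc (pred y) ≤ y
    suc-pred-≤ {y = suc y} _ = ≤-refl
  split (no z≮y) = cong₂ _+_ (guard-no (z <? y) z≮y)
    (trans (moveSum-cong z {k ∘ (z ∷_)} {λ _ → 0} μ (λ ν → guard-no (z <? y) z≮y)) (moveSum-0 z μ))

-- The identity DU − UD = 1 of Young's lattice, restricted to moves of a box to a higher row.
removeSum-moveSum : ∀ x g {μ} → Partition μ → part μ 0 ≤ x →
  moveSum x (removeSum g) μ + guard (part μ 0 ≟ x) (removeSum g μ)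
    ≡ removeSum (moveSum x g) μ + repeatedSum x g μ
removeSum-moveSum x g []                _   = guard-0 (0 ≟ x)
removeSum-moveSum x g {y ∷ μ} (z≤y ∷ P) y≤x = begin
  moveSum x (removeSum g) (y ∷ μ) + guard (y ≟ x) (removeSum g (y ∷ μ))
    ≡⟨ cong (_+ guard (y ≟ x) (removeSum g (y ∷ μ))) (moveSum-∷ x (removeSum g) y μ) ⟩
  (guard (y <? x) (removeSum (λ ν → removeSum g (suc y ∷ ν)) μ)
    + moveSum y (λ ν → removeSum g (y ∷ ν)) μ) + guard (y ≟ x) (removeSum g (y ∷ μ))
    ≡⟨ cong (_+ guard (y ≟ x) (removeSum g (y ∷ μ))) (cong₂ _+_ (cong (guard (y <? x)) raised) lowered) ⟩
  (guard (y <? x) (a + b) + (guard (part μ 0 <? y) c + e)) + guard (y ≟ x) (guard (part μ 0 <? y) p + a)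
    ≡⟨ cases z≤y (y <? x) (y ≟ x) (part μ 0 <? y) (part μ 0 ≟ y) (pred y <? x)
         (removeSum-moveSum y (g ∘ (y ∷_)) P z≤y) ⟩
  (guard (part μ 0 <? y) (guard (pred y <? x) a + c) + (guard (y <? x) b + q))
    + (guard (y ≟ x) (guard (part μ 0 <? y) p) + r)
    ≡⟨ cong (_+ repeatedSum x g (y ∷ μ)) (cong₂ _+_
         (guard-cong (part μ 0 <? y) (λ z<y → sym (trans (moveSum-∷ x g (pred y) μ)
           (cong (λ w → guard (pred y <? x) (removeSum (g ∘ (w ∷_)) μ) + c) (1+pred z<y)))))
         (sym kept)) ⟩
  removeSum (moveSum x g) (y ∷ μ) + repeatedSum x g (y ∷ μ) ∎
  where
  open ≡-Reasoning
  -- Sorted by the fate of the head row: it gains a box in `b`, loses one in `c` and `p`, and ends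
  -- with length `y` in `a`, `e`, `q` and `r`.
  a b c e p q r : ℕ
  a = removeSum (g ∘ (y ∷_)) μ
  b = removeSum (removeSum (g ∘ (suc y ∷_))) μ
  c = moveSum (pred y) (g ∘ (pred y ∷_)) μ
  e = moveSum y (removeSum (g ∘ (y ∷_))) μ
  p = g (pred y ∷ μ)
  q = removeSum (moveSum y (g ∘ (y ∷_))) μ
  r = repeatedSum y (g ∘ (y ∷_)) μ

  raised : removeSum (λ ν → removeSum g (suc y ∷ ν)) μ ≡ a + b
  raised = trans
    (removeSum-cong {λ ν → removeSum g (suc y ∷ ν)} {λ ν → g (y ∷ ν) + removeSum (g ∘ (suc y ∷_)) ν} μ
      (λ j _ → cong (_+ removeSum (g ∘ (suc y ∷_)) (decAt j μ))
      (guard-yes (part (decAt j μ) 0 <? suc y) (s≤s (≤-trans (decAt-head j μ) z≤y)))))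
    (removeSum-+ (g ∘ (y ∷_)) (removeSum (g ∘ (suc y ∷_))) μ)

  lowered : moveSum y (λ ν → removeSum g (y ∷ ν)) μ ≡ guard (part μ 0 <? y) c + e
  lowered = trans
    (moveSum-+ y (λ ν → guard (part ν 0 <? y) (g (pred y ∷ ν))) (removeSum (g ∘ (y ∷_))) μ)
    (cong (_+ e) (moveSum-below y (g ∘ (pred y ∷_)) {μ} z≤y))

  kept : removeSum (λ ν → moveSum x g (y ∷ ν)) μ ≡ guard (y <? x) b + q
  kept = begin
    removeSum (λ ν → moveSum x g (y ∷ ν)) μ
      ≡⟨ removeSum-cong {λ ν → moveSum x g (y ∷ ν)}
           {λ ν → guard (y <? x) (removeSum (g ∘ (suc y ∷_)) ν) + moveSum y (g ∘ (y ∷_)) ν}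
           μ (λ j _ → moveSum-∷ x g y (decAt j μ)) ⟩
    removeSum (λ ν → guard (y <? x) (removeSum (g ∘ (suc y ∷_)) ν) + moveSum y (g ∘ (y ∷_)) ν) μ
      ≡⟨ removeSum-+ (λ ν → guard (y <? x) (removeSum (g ∘ (suc y ∷_)) ν)) (moveSum y (g ∘ (y ∷_))) μ ⟩
    removeSum (λ ν → guard (y <? x) (removeSum (g ∘ (suc y ∷_)) ν)) μ + q
      ≡⟨ cong (_+ q) (removeSum-guard (y <? x) (removeSum (g ∘ (suc y ∷_))) μ) ⟩
    guard (y <? x) b + q ∎

  1+pred : ∀ {z y} → z < y → suc (pred y) ≡ y
  1+pred (s≤s _) = refl

  arith₁ : ∀ a b c e q r → e + 0 ≡ q + r → (a + b) + (c + e) + 0 ≡ ((a + c) + (b + q)) + (0 + r)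
  arith₁ a b c e q r ih = begin
    (a + b) + (c + e) + 0       ≡⟨ l a b c e ⟩
    (a + b + c) + (e + 0)       ≡⟨ cong (a + b + c +_) ih ⟩
    (a + b + c) + (q + r)       ≡⟨ m a b c q r ⟩
    ((a + c) + (b + q)) + (0 + r) ∎
    where
    l : ∀ a b c e → (a + b) + (c + e) + 0 ≡ (a + b + c) + (e + 0)
    l = solve-∀
    m : ∀ a b c q r → (a + b + c) + (q + r) ≡ ((a + c) + (b + q)) + (0 + r)
    m = solve-∀

  arith₂ : ∀ a b e q r → e + a ≡ q + r → (a + b) + (0 + e) + 0 ≡ (b + q) + (0 + r)
  arith₂ a b e q r ih = begin
    (a + b) + (0 + e) + 0 ≡⟨ l a b e ⟩
    b + (e + a)           ≡⟨ cong (b +_) ih ⟩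
    b + (q + r)           ≡⟨ +-assoc b q r ⟨
    (b + q) + (0 + r)     ∎
    where
    l : ∀ a b e → (a + b) + (0 + e) + 0 ≡ b + (e + a)
    l = solve-∀

  arith₃ : ∀ a c e p q r → e + 0 ≡ q + r → (c + e) + (p + a) ≡ ((a + c) + q) + (p + r)
  arith₃ a c e p q r ih = begin
    (c + e) + (p + a)       ≡⟨ l a c e p ⟩
    (a + c + p) + (e + 0)   ≡⟨ cong (a + c + p +_) ih ⟩
    (a + c + p) + (q + r)   ≡⟨ m a c p q r ⟩
    ((a + c) + q) + (p + r) ∎
    where
    l : ∀ a c e p → (c + e) + (p + a) ≡ (a + c + p) + (e + 0)
    l = solve-∀
    m : ∀ a c p q r → (a + c + p) + (q + r) ≡ ((a + c) + q) + (p + r)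
    m = solve-∀

  -- The point is to account for `a`. On the left it always occurs once: if `y < x`, because the
  -- head gains a box and loses it again; if `y ≡ x`, in the boundary term. On the right it is
  -- visible if `z < y`; if `z ≡ y`, it is contained in `q + r`, because the induction hypothesis
  -- has its own boundary term with bound `y`.
  cases : ∀ {z} → z ≤ y → (d₁ : Dec (y < x)) (d₂ : Dec (y ≡ x)) (d₃ : Dec (z < y)) (d₄ : Dec (z ≡ y))
    (d₅ : Dec (pred y < x)) → e + guard d₄ a ≡ q + r →
    (guard d₁ (a + b) + (guard d₃ c + e)) + guard d₂ (guard d₃ p + a)
      ≡ (guard d₃ (guard d₅ a + c) + (guard d₁ b + q)) + (guard d₂ (guard d₃ p) + r)
  cases _ (yes y<x) (yes y≡x) _         _         _  _  = contradiction y≡x (<⇒≢ y<x)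
  cases _ (no y≮x)  (no y≢x)  _         _         _  _  = contradiction (≤∧≢⇒< y≤x y≢x) y≮x
  cases _ _         _         (yes z<y) (yes z≡y) _  _  = contradiction z≡y (<⇒≢ z<y)
  cases z≤y _       _         (no z≮y)  (no z≢y)  _  _  = contradiction (≤∧≢⇒< z≤y z≢y) z≮y
  cases _ _         _         (yes z<y) _ (no y-1≮x) _  =
    contradiction (≤-trans (≤-reflexive (1+pred z<y)) y≤x) y-1≮x
  cases _ (yes _)   (no _)    (yes _)   (no _)    (yes _) ih = arith₁ a b c e q r ih
  cases _ (yes _)   (no _)    (no _)    (yes _)   _       ih = arith₂ a b e q r ih
  cases _ (no _)    (yes _)   (yes _)   (no _)    (yes _) ih = arith₃ a c e p q r ih
  cases _ (no _)    (yes _)   (no _)    (yes _)   _       ih = ih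

-- Counts and the index set of the theorem

part≤head : ∀ {μ} → Partition μ → ∀ j → part μ j ≤ part μ 0
part≤head []        j       = z≤n
part≤head (z≤y ∷ P) zero    = ≤-refl
part≤head (z≤y ∷ P) (suc j) = ≤-trans (part≤head P j) z≤y

part≤sum : ∀ μ j → part μ j ≤ sum μ
part≤sum []      j       = z≤n
part≤sum (y ∷ μ) zero    = m≤m+n y (sum μ)
part≤sum (y ∷ μ) (suc j) = ≤-trans (part≤sum μ j) (m≤n+m (sum μ) y)

sum-decAt : ∀ j μ → 0 < part μ j → suc (sum (decAt j μ)) ≡ sum μ
sum-decAt zero    (suc y ∷ μ) _ = refl
sum-decAt (suc j) (y ∷ μ)     p = trans (sym (+-suc y _)) (cong (y +_) (sum-decAt j μ p))

sum-incAt : ∀ j μ → j < length μ → sum (incAt j μ) ≡ suc (sum μ)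
sum-incAt zero    (y ∷ μ) _         = refl
sum-incAt (suc j) (y ∷ μ) (s≤s j<m) = trans (cong (y +_) (sum-incAt j μ j<m)) (+-suc y (sum μ))

incAt-partition : ∀ a {x μ} → Partition μ → part μ 0 ≤ x → part μ a < part (x ∷ μ) a →
  Partition (incAt a μ) × part (incAt a μ) 0 ≤ x
incAt-partition a       []        _   c = [] , z≤n
incAt-partition zero    (z≤y ∷ P) y≤x c = m≤n⇒m≤1+n z≤y ∷ P , c
incAt-partition (suc a) (z≤y ∷ P) y≤x c with incAt-partition a P z≤y c
... | P′ , z′≤y = z′≤y ∷ P′ , y≤x

part-incAt-> : ∀ {a b} μ → a < b → part (incAt a μ) b ≡ part μ b
part-incAt->                  []      _         = refl
part-incAt-> {zero}  {suc b} (y ∷ μ) _         = refl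
part-incAt-> {suc a} {suc b} (y ∷ μ) (s≤s a<b) = part-incAt-> μ a<b

count₀ : ℕ → List ℕ → ℕ
count₀ zero    μ = 1
count₀ (suc n) μ = removeSum (count₀ n) μ

-- `n` is meant to be the number of boxes. The bound `suc (part μ 0)` stands for λ₀ = ∞, so the
-- first row gives no repeated term.
count₁ : ℕ → List ℕ → ℕ
count₁ zero    μ = 0
count₁ (suc n) μ = removeSum (count₁ n) μ + repeatedSum (suc (part μ 0)) (count₀ n) μ

repeatedSum-> : ∀ {x} g μ → part μ 0 < x →
  repeatedSum x g μ ≡ repeatedSum (suc (part μ 0)) g μ
repeatedSum-> g []      _   = refl
repeatedSum-> {x} g (y ∷ μ) y<x = cong (_+ repeatedSum y (g ∘ (y ∷_)) μ)
  (trans (guard-no (y ≟ x) (<⇒≢ y<x)) (sym (guard-no (y ≟ suc y) (<⇒≢ ≤-refl))))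

-- A move keeps the number of boxes, so `count₀ (suc n)` unfolds to `removeSum (count₀ n)` under
-- `moveSum x`, and the commutation applies with a vanishing boundary term. The bound `x` stays
-- fixed while the first row may shrink; hence an arbitrary `x` above `part μ 0`.
moveSum-count₀ : ∀ n {x μ} → Partition μ → sum μ ≡ n → part μ 0 < x →
  moveSum x (count₀ n) μ ≡ count₁ n μ
-- `count₀ zero` is 1 on every list; the sum vanishes because a shape without boxes has no corner to
-- move from.
moveSum-count₀ zero {x} {μ} P Σ≡0 _ = trans
  (∑△-cong (length μ) λ a b _ _ → trans
    (cong (guard (addable? x μ a)) (guard-no (corner? μ b) (λ c →
      contradiction (<-≤-trans c (≤-trans (part≤sum μ b) (≤-reflexive Σ≡0))) λ ())))
    (guard-0 (addable? x μ a)))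
  (trans (sym (∑△-correct (length μ) (λ _ _ → 0)))
    (trans (∑-cong (length μ) (λ s _ → ∑-0 s)) (∑-0 (length μ))))
moveSum-count₀ (suc n) {x} {μ} P Σ≡n+1 z<x = begin
  moveSum x (removeSum (count₀ n)) μ
    ≡⟨ +-identityʳ _ ⟨
  moveSum x (removeSum (count₀ n)) μ + 0
    ≡⟨ cong (moveSum x (removeSum (count₀ n)) μ +_) (guard-no (part μ 0 ≟ x) (<⇒≢ z<x)) ⟨
  moveSum x (removeSum (count₀ n)) μ + guard (part μ 0 ≟ x) (removeSum (count₀ n) μ)
    ≡⟨ removeSum-moveSum x (count₀ n) P (<⇒≤ z<x) ⟩
  removeSum (moveSum x (count₀ n)) μ + repeatedSum x (count₀ n) μ
    ≡⟨ cong₂ _+_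
         (removeSum-cong {moveSum x (count₀ n)} {count₁ n} μ λ j c → moveSum-count₀ n (decAt-partition j P c)
           (suc-injective (trans (sum-decAt j μ (≤-<-trans z≤n c)) Σ≡n+1))
           (≤-<-trans (decAt-head j μ) z<x))
         (repeatedSum-> (count₀ n) μ z<x) ⟩
  removeSum (count₁ n) μ + repeatedSum (suc (part μ 0)) (count₀ n) μ ∎
  where open ≡-Reasoning

-- Omitting rows of length zero

dropZeros-idem : ∀ μ → dropZeros (dropZeros μ) ≡ dropZeros μ
dropZeros-idem []          = refl
dropZeros-idem (zero ∷ μ)  = dropZeros-idem μ
dropZeros-idem (suc y ∷ μ) = cong (suc y ∷_) (dropZeros-idem μ)

dropZeros-zeros : ∀ {μ} → Partition μ → part μ 0 ≤ 0 → dropZeros μ ≡ []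
dropZeros-zeros []                   _ = refl
dropZeros-zeros {zero ∷ μ} (z≤0 ∷ P) _ = dropZeros-zeros P z≤0

dropZeros-head : ∀ {μ} → Partition μ → part (dropZeros μ) 0 ≡ part μ 0
dropZeros-head []                    = refl
dropZeros-head {zero ∷ μ}  (z≤0 ∷ P) = cong (λ ν → part ν 0) (dropZeros-zeros P z≤0)
dropZeros-head {suc y ∷ μ} _         = refl

dropZeros-partition : ∀ {μ} → Partition μ → Partition (dropZeros μ)
dropZeros-partition []                    = []
dropZeros-partition {zero ∷ μ}  (_ ∷ P)   = dropZeros-partition P
dropZeros-partition {suc y ∷ μ} (z≤y ∷ P) =
  ≤-trans (≤-reflexive (dropZeros-head P)) z≤y ∷ dropZeros-partition P

sum-dropZeros : ∀ μ → sum (dropZeros μ) ≡ sum μ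
sum-dropZeros []          = refl
sum-dropZeros (zero ∷ μ)  = sum-dropZeros μ
sum-dropZeros (suc y ∷ μ) = cong (suc y +_) (sum-dropZeros μ)

removeSum-zeros : ∀ g {μ} → Partition μ → part μ 0 ≤ 0 → removeSum g μ ≡ 0
removeSum-zeros g {μ} P z≤0 = trans
  (∑-cong (length μ) λ j _ → guard-no (corner? μ j) λ c →
    contradiction (<-≤-trans c (≤-trans (part≤head P j) z≤0)) λ ())
  (∑-0 (length μ))

-- Zero rows are never corners. The bound `x` serves the induction: below a row `suc y`, the
-- function `g ∘ (suc y ∷_)` is known to respect `dropZeros` only on tails whose first row is at
-- most `suc y`.
removeSum-dropZeros : ∀ g {x μ} → Partition μ → part μ 0 ≤ x →
  (∀ {ν} → Partition ν → part ν 0 ≤ x → g (dropZeros ν) ≡ g ν) →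
  removeSum g (dropZeros μ) ≡ removeSum g μ
removeSum-dropZeros g []        _   inv = refl
removeSum-dropZeros g {x} {zero ∷ μ} P@(z≤0 ∷ P′) _ inv =
  trans (cong (removeSum g) (dropZeros-zeros P′ z≤0)) (sym (removeSum-zeros g P ≤-refl))
removeSum-dropZeros g {x} {suc y ∷ μ} (z≤1+y ∷ P) y<x inv = cong₂ _+_
  (trans (guard-⇔ (part (dropZeros μ) 0 <? suc y) (part μ 0 <? suc y)
           (subst (_< suc y) (dropZeros-head P)) (subst (_< suc y) (sym (dropZeros-head P))))
         -- The shortened row `y` may now be empty itself, so `y ∷ dropZeros μ` and `y ∷ μ` are
         -- compared through their common `dropZeros`.
         (guard-cong (part μ 0 <? suc y) λ z<1+y → trans
           (sym (inv (subst (_≤ y) (sym (dropZeros-head P)) (s≤s⁻¹ z<1+y) ∷ dropZeros-partition P) (<⇒≤ y<x)))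
           (trans (cong g (dropZeros-∷ y)) (inv (s≤s⁻¹ z<1+y ∷ P) (<⇒≤ y<x)))))
  (removeSum-dropZeros (g ∘ (suc y ∷_)) P z≤1+y (λ Q w≤1+y → inv (w≤1+y ∷ Q) y<x))
  where
  dropZeros-∷ : ∀ y → dropZeros (y ∷ dropZeros μ) ≡ dropZeros (y ∷ μ)
  dropZeros-∷ zero    = dropZeros-idem μ
  dropZeros-∷ (suc y) = cong (suc y ∷_) (dropZeros-idem μ)

count₀-dropZeros : ∀ n {μ} → Partition μ → count₀ n (dropZeros μ) ≡ count₀ n μ
count₀-dropZeros zero    P = refl
count₀-dropZeros (suc n) P = removeSum-dropZeros (count₀ n) P ≤-refl (λ Q _ → count₀-dropZeros n Q)

-- Tuples E as moves of one box

addEAt-past : ∀ {i₁ i₂} k μ → i₁ < k → i₂ < k → addEAt i₁ i₂ k μ ≡ μ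
addEAt-past k []      _    _    = refl
addEAt-past {i₁} {i₂} k (y ∷ μ) i₁<k i₂<k
  rewrite dec-false (k ≟ i₁) (≢-sym (<⇒≢ i₁<k)) | dec-false (k ≟ i₂) (≢-sym (<⇒≢ i₂<k))
  = cong (y ∷_) (addEAt-past (suc k) μ (m<n⇒m<1+n i₁<k) (m<n⇒m<1+n i₂<k))

addEAt-decAt : ∀ {i₂} k b μ → i₂ < k → addEAt (k + b) i₂ k μ ≡ decAt b μ
addEAt-decAt k b       []      _    = refl
addEAt-decAt {i₂} k zero (y ∷ μ) i₂<k
  rewrite +-identityʳ k | dec-true (k ≟ k) refl
  = cong₂ _∷_ refl (addEAt-past (suc k) μ ≤-refl (m<n⇒m<1+n i₂<k))
addEAt-decAt {i₂} k (suc b) (y ∷ μ) i₂<k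
  rewrite dec-false (k ≟ k + suc b) (<⇒≢ (m<m+n k z<s)) | dec-false (k ≟ i₂) (≢-sym (<⇒≢ i₂<k))
        | +-suc k b
  = cong (y ∷_) (addEAt-decAt (suc k) b μ (m<n⇒m<1+n i₂<k))

addEAt-move : ∀ k {a b} μ → a < b → addEAt (k + b) (k + a) k μ ≡ decAt b (incAt a μ)
addEAt-move k [] _ = refl
addEAt-move k {zero} {suc b} (y ∷ μ) _
  rewrite dec-false (k ≟ k + suc b) (<⇒≢ (m<m+n k z<s)) | +-identityʳ k | dec-true (k ≟ k) refl
        | +-suc k b
  = cong (suc y ∷_) (addEAt-decAt (suc k) b μ ≤-refl)
addEAt-move k {suc a} {suc b} (y ∷ μ) (s≤s a<b)
  rewrite dec-false (k ≟ k + suc b) (<⇒≢ (m<m+n k z<s)) | dec-false (k ≟ k + suc a) (<⇒≢ (m<m+n k z<s))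
        | +-suc k b | +-suc k a
  = cong (y ∷_) (addEAt-move (suc k) μ a<b)

lam-part : ∀ μ i → lam μ (suc i) ≡ part μ i
lam-part []      i       = refl
lam-part (y ∷ μ) zero    = refl
lam-part (y ∷ μ) (suc i) = lam-part μ i

0<∸⇒< : ∀ {m n} → 0 < m ∸ n → n < m
0<∸⇒< {m} {n} p = m∸n≢0⇒n<m (≢-sym (<⇒≢ p))

module _ {x : ℕ} (μ : List ℕ) {a b : ℕ} (μ₁<x : part μ 0 < x) where

  validE⇒addable : ValidE μ (suc b) (suc a) → part μ a < part (x ∷ μ) a
  validE⇒addable = addable a
    where
    addable : ∀ a → ValidE μ (suc b) (suc a) → part μ a < part (x ∷ μ) a
    addable zero    _                        = μ₁<x
    addable (suc a) (_ , _ , _ , _ , inj₂ p) =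
      subst₂ _<_ (lam-part μ (suc a)) (lam-part μ a) (0<∸⇒< p)

  validE⇒corner : ValidE μ (suc b) (suc a) → part μ (suc b) < part μ b
  validE⇒corner (_ , _ , _ , p , _) = subst₂ _<_ (lam-part μ (suc b)) (lam-part μ b) (0<∸⇒< p)

  addable-corner⇒validE : a < b → b < length μ →
    part μ a < part (x ∷ μ) a → part μ (suc b) < part μ b → ValidE μ (suc b) (suc a)
  addable-corner⇒validE a<b b<m p c = s≤s z≤n , s≤s a<b , b<m ,
    m<n⇒0<n∸m (subst₂ _<_ (sym (lam-part μ (suc b))) (sym (lam-part μ b)) c) , dtPos′ a p
    where
    dtPos′ : ∀ a → part μ a < part (x ∷ μ) a → dtPos μ (suc a)
    dtPos′ zero    _ = inj₁ refl
    dtPos′ (suc a) p = inj₂ (m<n⇒0<n∸m (subst₂ _<_ (sym (lam-part μ (suc a))) (sym (lam-part μ a)) p))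

sumE-moveSum : ∀ {x} μ f g → part μ 0 < x →
  (∀ a b → a < b → ValidE μ (suc b) (suc a) → f (suc b) (suc a) ≡ g (decAt b (incAt a μ))) →
  sumE μ f ≡ moveSum x g μ
sumE-moveSum {x} μ f g μ₁<x eq = begin
  sumE μ f
    ≡⟨ ∑-upTo (suc m) (λ i₁ → sum (map (summand i₁) (upTo i₁))) ⟩
  ∑ (suc m) (λ i₁ → sum (map (summand i₁) (upTo i₁)))
    ≡⟨ ∑-cong (suc m) (λ i₁ _ → ∑-upTo i₁ (summand i₁)) ⟩
  ∑ (suc m) (λ i₁ → ∑ i₁ (summand i₁))
    ≡⟨ ∑△-correct (suc m) (λ i₂ i₁ → summand i₁ i₂) ⟩
  ∑ m (λ b → summand (suc b) 0) + ∑△ m (λ a b → summand (suc b) (suc a))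
    -- `sumE` numbers rows from 1 but lets `i₂` start at 0. The terms with `i₂ = 0` split off and
    -- are never valid; the others are shifted to rows numbered from 0.
    ≡⟨ cong₂ _+_ (trans (∑-cong m (λ b _ → guard-no (validE? μ (suc b) 0) {f (suc b) 0} λ ())) (∑-0 m))
         (∑△-cong m term) ⟩
  moveSum x g μ ∎
  where
  open ≡-Reasoning
  m : ℕ
  m = length μ
  summand : ℕ → ℕ → ℕ
  summand i₁ i₂ = guard (validE? μ i₁ i₂) (f i₁ i₂)
  term : ∀ a b → a < b → b < m → summand (suc b) (suc a)
    ≡ guard (addable? x μ a) (guard (corner? μ b) (g (decAt b (incAt a μ))))
  term a b a<b b<m = trans
    (guard-cong (validE? μ (suc b) (suc a)) (eq a b a<b))
    (guard-× (validE? μ (suc b) (suc a)) (addable? x μ a) (corner? μ b)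
      (validE⇒addable μ μ₁<x) (validE⇒corner μ {a} μ₁<x) (addable-corner⇒validE μ μ₁<x a<b b<m))

-- Inversions by pairs of rows

rowInv : List ℕ → List ℕ → ℕ
rowInv []      _       = 0
rowInv (_ ∷ _) []      = 0
rowInv (t ∷ R) (b ∷ Q) = pairInv t (R !? 0) b (Q !? 0) + rowInv R Q

invBelow : List ℕ → Tab → ℕ
invBelow R []      = 0
invBelow R (Q ∷ T) = rowInv R Q + invBelow R T

inv : Tab → ℕ
inv []      = 0
inv (R ∷ T) = invBelow R T + inv T

row : Tab → ℕ → List ℕ
row []      _       = []
row (R ∷ T) zero    = R
row (R ∷ T) (suc r) = row T r

cellInv : Maybe ℕ → Maybe ℕ → Maybe ℕ → Maybe ℕ → ℕ
cellInv nothing  _  _        _  = 0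
cellInv (just _) _  nothing  _  = 0
cellInv (just t) tr (just b) br = pairInv t tr b br

colInv : List ℕ → List ℕ → ℕ → ℕ
colInv R Q c = cellInv (R !? c) (R !? suc c) (Q !? c) (Q !? suc c)

cell-row : ∀ T r c → cell T r c ≡ row T r !? c
cell-row []      r       c = refl
cell-row (R ∷ T) zero    c = refl
cell-row (R ∷ T) (suc r) c = cell-row T r c

invAt-cellInv : ∀ T r r′ c →
  invAt T r r′ c ≡ cellInv (cell T r c) (cell T r (suc c)) (cell T r′ c) (cell T r′ (suc c))
invAt-cellInv T r r′ c with cell T r c | cell T r′ c
... | nothing | nothing = refl
... | nothing | just _  = refl
... | just _  | nothing = refl
... | just _  | just _  = refl

invAt-colInv : ∀ T r r′ c → invAt T r r′ c ≡ colInv (row T r) (row T r′) c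
invAt-colInv T r r′ c
  rewrite invAt-cellInv T r r′ c | cell-row T r c | cell-row T r (suc c)
        | cell-row T r′ c | cell-row T r′ (suc c) = refl

-- In `inversions` the column runs up to the total number of entries; columns past the end of either
-- row contribute nothing.
∑-colInv : ∀ L R Q → length R ≤ L → ∑ L (colInv R Q) ≡ rowInv R Q
∑-colInv L       []      Q       _         = ∑-0 L
∑-colInv L       (t ∷ R) []      _         = trans (∑-cong L (λ c _ → no-lower-cell ((t ∷ R) !? c))) (∑-0 L)
  where
  no-lower-cell : ∀ m {m′} → cellInv m m′ nothing nothing ≡ 0
  no-lower-cell nothing  = refl
  no-lower-cell (just _) = refl
∑-colInv (suc L) (t ∷ R) (b ∷ Q) (s≤s R≤L) = cong (pairInv t (R !? 0) b (Q !? 0) +_) (∑-colInv L R Q R≤L)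

length-row≤ : ∀ T r → length (row T r) ≤ length (concat T)
length-row≤ []      r       = z≤n
length-row≤ (R ∷ T) zero    = ≤-trans (m≤m+n _ _) (≤-reflexive (sym (length-++ R)))
length-row≤ (R ∷ T) (suc r) =
  ≤-trans (length-row≤ T r) (≤-trans (m≤n+m _ (length R)) (≤-reflexive (sym (length-++ R))))

∑-invBelow : ∀ R T → ∑ (length T) (rowInv R ∘ row T) ≡ invBelow R T
∑-invBelow R []      = refl
∑-invBelow R (Q ∷ T) = cong (rowInv R Q +_) (∑-invBelow R T)

∑△-inv : ∀ T → ∑△ (length T) (λ r s → rowInv (row T r) (row T s)) ≡ inv T
∑△-inv []      = refl
∑△-inv (R ∷ T) = cong₂ _+_ (∑-invBelow R T) (∑△-inv T)

inversions-inv : ∀ T → inversions T ≡ inv T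
inversions-inv T = begin
  inversions T
    ≡⟨ ∑-upTo (length T) _ ⟩
  ∑ (length T) (λ s → sum (map (λ r → sum (map (invAt T r s) (upTo L))) (upTo s)))
    ≡⟨ ∑-cong (length T) (λ s _ → trans (∑-upTo s _) (∑-cong s (λ r _ → trans (∑-upTo L (invAt T r s))
         (trans (∑-cong L (λ c _ → invAt-colInv T r s c))
                (∑-colInv L (row T r) (row T s) (length-row≤ T r)))))) ⟩
  ∑ (length T) (λ s → ∑ s (λ r → rowInv (row T r) (row T s)))
    ≡⟨ ∑△-correct (length T) (λ r s → rowInv (row T r) (row T s)) ⟩
  ∑△ (length T) (λ r s → rowInv (row T r) (row T s))
    ≡⟨ ∑△-inv T ⟩
  inv T ∎
  where
  open ≡-Reasoning
  L : ℕ
  L = length (concat T)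

-- Appending the largest entry

-- No cell of `Q` lies under the new cell. The former last cell of `R` acquires a right neighbour,
-- but a cell of `Q` under it is the last of `Q`, so condition (1) still decides that pair.
rowInv-∷ʳ-below : ∀ R Q N → length Q ≤ length R → rowInv (R ∷ʳ N) Q ≡ rowInv R Q
rowInv-∷ʳ-below []          []          N _         = refl
rowInv-∷ʳ-below (t ∷ [])    []          N _         = refl
rowInv-∷ʳ-below (t ∷ [])    (b ∷ [])    N _ with does (t <? b)
... | true  = refl
... | false = refl
rowInv-∷ʳ-below (t ∷ [])    (b ∷ _ ∷ _) N (s≤s ())
rowInv-∷ʳ-below (t ∷ _ ∷ R) []          N _         = refl
rowInv-∷ʳ-below (t ∷ u ∷ R) (b ∷ Q)     N (s≤s Q≤R) =
  cong (pairInv t (just u) b (Q !? 0) +_) (rowInv-∷ʳ-below (u ∷ R) Q N Q≤R)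

-- When the lower row ends, condition (1) gives the same verdict as condition (2) would if a larger
-- entry `N` followed, so the last pair keeps its value. The new pair has the smaller entry on top
-- and no right neighbour below, hence is no inversion.
rowInv-∷ʳ-above : ∀ R Q {N} → All (_< N) R → length Q < length R → rowInv R (Q ∷ʳ N) ≡ rowInv R Q
rowInv-∷ʳ-above (t ∷ R) [] {N} (t<N ∷ _) _
  rewrite dec-true (t <? N) t<N with R
... | []    = refl
... | _ ∷ _ = refl
rowInv-∷ʳ-above (t ∷ []) (b ∷ Q) _ (s≤s ())
rowInv-∷ʳ-above (t ∷ u ∷ R) (b ∷ []) {N} (_ ∷ u<N ∷ R<N) _ =
  cong₂ _+_ lastPair (rowInv-∷ʳ-above (u ∷ R) [] (u<N ∷ R<N) z<s)
  where
  lastPair : pairInv t (just u) b (just N) ≡ pairInv t (just u) b nothing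
  lastPair with does (t <? b)
  ... | true  rewrite dec-false (N <? u) (<⇒≯ u<N) = refl
  ... | false rewrite dec-true (u <? N) u<N = refl
rowInv-∷ʳ-above (t ∷ u ∷ R) (b ∷ c ∷ Q) {N} (_ ∷ R<N) (s≤s Q<R) =
  cong (pairInv t (just u) b (just c) +_) (rowInv-∷ʳ-above (u ∷ R) (c ∷ Q) R<N Q<R)

pairInv-sym : ∀ {t b} t′ b′ → t ≢ b → pairInv t (just t′) b (just b′) ≡ pairInv b (just b′) t (just t′)
pairInv-sym {t} {b} t′ b′ t≢b with <-cmp t b
... | tri< t<b _ b≮t rewrite dec-true (t <? b) t<b | dec-false (b <? t) b≮t = refl
... | tri≈ _ t≡b _   = contradiction t≡b t≢b
... | tri> t≮b _ b<t rewrite dec-true (b <? t) b<t | dec-false (t <? b) t≮b = refl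

head-∷ʳ : ∀ (R : List ℕ) N → ∃ λ u → (R ∷ʳ N) !? 0 ≡ just u
head-∷ʳ []      N = N , refl
head-∷ʳ (u ∷ _) N = u , refl

-- Condition (2) does not mention which row is on top, so all columns but the last are unaffected.
-- In the last column only condition (1) applies: `N` above a smaller entry is an inversion, below
-- it is not.
rowInv-swap : ∀ R Q {N} → length Q ≡ suc (length R) → All (_< N) Q →
  (∀ {x} → x ∈ R → x ∉ Q) → rowInv (R ∷ʳ N) Q ≡ suc (rowInv Q (R ∷ʳ N))
rowInv-swap []      (b ∷ [])    {N} _  (b<N ∷ _)   _
  rewrite dec-true (b <? N) b<N | dec-false (N <? b) (<⇒≯ b<N) = refl
rowInv-swap (t ∷ R) (b ∷ c ∷ Q) {N} eq (_ ∷ Q<N) disj with head-∷ʳ R N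
... | u , hd≡u rewrite hd≡u = trans
  (cong₂ _+_ (pairInv-sym {t} {b} u c (λ { refl → disj (here refl) (here refl) }))
    (rowInv-swap R (c ∷ Q) (suc-injective eq) Q<N (λ x∈R x∈Q → disj (there x∈R) (there x∈Q))))
  (+-suc (pairInv b (just c) t (just u)) (rowInv (c ∷ Q) (R ∷ʳ N)))

appendAt : ℕ → ℕ → Tab → Tab
appendAt _       N []      = []
appendAt zero    N (R ∷ T) = (R ∷ʳ N) ∷ T
appendAt (suc j) N (R ∷ T) = R ∷ appendAt j N T

swapAt : ℕ → Tab → Tab
swapAt zero    (R ∷ Q ∷ T) = Q ∷ R ∷ T
swapAt (suc j) (R ∷ T)     = R ∷ swapAt j T
swapAt _       T           = T

swapAt-swapAt : ∀ j T → swapAt j (swapAt j T) ≡ T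
swapAt-swapAt zero    []          = refl
swapAt-swapAt zero    (_ ∷ [])    = refl
swapAt-swapAt zero    (_ ∷ _ ∷ _) = refl
swapAt-swapAt (suc j) []          = refl
swapAt-swapAt (suc j) (R ∷ T)     = cong (R ∷_) (swapAt-swapAt j T)

swapAt-↭ : ∀ j T → swapAt j T ↭ T
swapAt-↭ zero    []          = ↭-refl
swapAt-↭ zero    (_ ∷ [])    = ↭-refl
swapAt-↭ zero    (R ∷ Q ∷ T) = ↭-swap Q R ↭-refl
swapAt-↭ (suc j) []          = ↭-refl
swapAt-↭ (suc j) (R ∷ T)     = ↭-prep R (swapAt-↭ j T)

concat-swapAt : ∀ j T → concat (swapAt j T) ↭ concat T
concat-swapAt zero    []          = ↭-refl
concat-swapAt zero    (_ ∷ [])    = ↭-refl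
concat-swapAt zero    (R ∷ Q ∷ T) = shifts Q R
concat-swapAt (suc j) []          = ↭-refl
concat-swapAt (suc j) (R ∷ T)     = ++⁺ˡ R (concat-swapAt j T)

swapAt-appendAt : ∀ j N T → suc j < length T → swapAt j (appendAt j N T) ≡ appendAt (suc j) N (swapAt j T)
swapAt-appendAt zero    N (R ∷ Q ∷ T) _           = refl
swapAt-appendAt zero    N (R ∷ [])    (s≤s ())
swapAt-appendAt (suc j) N (R ∷ T)     (s≤s j+1<m) = cong (R ∷_) (swapAt-appendAt j N T j+1<m)

map-length-appendAt : ∀ j N T → map length (appendAt j N T) ≡ incAt j (map length T)
map-length-appendAt j       N []      = refl
map-length-appendAt zero    N (R ∷ T) = cong (_∷ map length T) (trans (length-++ R) (+-comm (length R) 1))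
map-length-appendAt (suc j) N (R ∷ T) = cong (length R ∷_) (map-length-appendAt j N T)

concat-appendAt : ∀ j N T → j < length T → concat (appendAt j N T) ↭ N ∷ concat T
concat-appendAt zero    N (R ∷ T) _         =
  ↭-trans (++⁺ʳ (concat T) (↭-sym (∷↭∷ʳ N R))) ↭-refl
concat-appendAt (suc j) N (R ∷ T) (s≤s j<m) =
  ↭-trans (++⁺ˡ R (concat-appendAt j N T j<m)) (shift N R (concat T))

Linked-∷ʳ⁺ : ∀ {R N} → Linked _<_ R → All (_< N) R → Linked _<_ (R ∷ʳ N)
Linked-∷ʳ⁺ []        _          = [-]
Linked-∷ʳ⁺ [-]       (x<N ∷ []) = x<N ∷ [-]
Linked-∷ʳ⁺ (x<y ∷ l) (_ ∷ R<N)  = x<y ∷ Linked-∷ʳ⁺ l R<N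

Linked-∷ʳ⁻ : ∀ R {N} → Linked _<_ (R ∷ʳ N) → Linked _<_ R
Linked-∷ʳ⁻ []          _         = []
Linked-∷ʳ⁻ (_ ∷ [])    _         = [-]
Linked-∷ʳ⁻ (_ ∷ _ ∷ _) (x<y ∷ l) = x<y ∷ Linked-∷ʳ⁻ _ l

appendAt-rowStandard⁺ : ∀ j {N T} → RowStandard T → All (All (_< N)) T → RowStandard (appendAt j N T)
appendAt-rowStandard⁺ j       []      _            = []
appendAt-rowStandard⁺ zero    (r ∷ s) (R<N ∷ _)    = Linked-∷ʳ⁺ r R<N ∷ s
appendAt-rowStandard⁺ (suc j) (r ∷ s) (_   ∷ T<N)  = r ∷ appendAt-rowStandard⁺ j s T<N

appendAt-rowStandard⁻ : ∀ j {N} T → RowStandard (appendAt j N T) → RowStandard T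
appendAt-rowStandard⁻ j       []      _       = []
appendAt-rowStandard⁻ zero    (R ∷ T) (r ∷ s) = Linked-∷ʳ⁻ R r ∷ s
appendAt-rowStandard⁻ (suc j) (R ∷ T) (r ∷ s) = r ∷ appendAt-rowStandard⁻ j T s

∈-∷ʳ : ∀ R {N : ℕ} → N ∈ R ∷ʳ N
∈-∷ʳ R = ∈-++⁺ʳ R (here refl)

-- Since `N` occurs in neither `T` nor `U`, the row that contains it identifies both `j` and `k`.
appendAt-injective : ∀ j k {N} T U → N ∉ concat T → N ∉ concat U → j < length T → k < length U →
  appendAt j N T ≡ appendAt k N U → j ≡ k × T ≡ U
appendAt-injective zero zero (R ∷ T) (Q ∷ U) N∉T N∉U _ _ eq with ∷-injective eq
... | eq₁ , refl = refl , cong (_∷ T) (proj₁ (∷ʳ-injective R Q eq₁))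
appendAt-injective zero (suc k) (R ∷ T) (Q ∷ U) N∉T N∉U _ _ eq =
  contradiction (∈-++⁺ˡ (subst (_ ∈_) (proj₁ (∷-injective eq)) (∈-∷ʳ R))) N∉U
appendAt-injective (suc j) zero (R ∷ T) (Q ∷ U) N∉T N∉U _ _ eq =
  contradiction (∈-++⁺ˡ (subst (_ ∈_) (sym (proj₁ (∷-injective eq))) (∈-∷ʳ Q))) N∉T
appendAt-injective (suc j) (suc k) (R ∷ T) (Q ∷ U) N∉T N∉U (s≤s j<m) (s≤s k<m) eq with ∷-injective eq
... | refl , eq′ with appendAt-injective j k T U (N∉T ∘ ∈-++⁺ʳ R) (N∉U ∘ ∈-++⁺ʳ R) j<m k<m eq′
... | refl , refl = refl , refl

max-last : ∀ {R N} → Linked _<_ R → All (_≤ N) R → N ∈ R → ∃ λ Q → R ≡ Q ∷ʳ N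
max-last [-]       _                (here refl) = [] , refl
max-last (x<y ∷ _) (_ ∷ y≤N ∷ _)    (here refl) = contradiction y≤N (<⇒≱ x<y)
max-last {x ∷ _} (_ ∷ l) (_ ∷ R≤N)  (there N∈R) with max-last l R≤N N∈R
... | Q , eq = x ∷ Q , cong (x ∷_) eq

remove-max : ∀ {T N} → RowStandard T → All (_≤ N) (concat T) → N ∈ concat T →
  ∃₂ λ j U → j < length U × T ≡ appendAt j N U
remove-max {R ∷ T} (r ∷ s) T≤N N∈T with ∈-++⁻ R N∈T
... | inj₁ N∈R with max-last r (All.++⁻ˡ R T≤N) N∈R
...   | Q , refl = 0 , Q ∷ T , z<s , refl
remove-max {R ∷ T} (r ∷ s) T≤N N∈T | inj₂ N∈T′ with remove-max s (All.++⁻ʳ R T≤N) N∈T′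
...   | j , U , j<m , refl = suc j , R ∷ U , s<s j<m , refl

invBelow-∷ʳ : ∀ R N T → All (λ Q → length Q ≤ length R) T → invBelow (R ∷ʳ N) T ≡ invBelow R T
invBelow-∷ʳ R N []      _           = refl
invBelow-∷ʳ R N (Q ∷ T) (Q≤R ∷ T≤R) = cong₂ _+_ (rowInv-∷ʳ-below R Q N Q≤R) (invBelow-∷ʳ R N T T≤R)

invBelow-appendAt : ∀ R j {N} T → All (_< N) R → part (incAt j (map length T)) j ≤ length R →
  invBelow R (appendAt j N T) ≡ invBelow R T
invBelow-appendAt R j       []      _   _   = refl
invBelow-appendAt R zero    (Q ∷ T) R<N Q<R = cong (_+ invBelow R T) (rowInv-∷ʳ-above R Q R<N Q<R)
invBelow-appendAt R (suc j) (Q ∷ T) R<N Q<R = cong (rowInv R Q +_) (invBelow-appendAt R j T R<N Q<R)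

lengths≤ : ∀ {l} (T : Tab) → Partition (map length T) → part (map length T) 0 ≤ l → All (λ Q → length Q ≤ l) T
lengths≤ []      _         _   = []
lengths≤ (Q ∷ T) (Q′≤Q ∷ P) Q≤l = Q≤l ∷ lengths≤ T P (≤-trans Q′≤Q Q≤l)

-- Rows above are at least as long as the extended row, which suits `rowInv-∷ʳ-above`. Rows below
-- must be at most as long as that row was before; this is the corner condition.
inv-appendAt-corner : ∀ j {N} T → Partition (incAt j (map length T)) → All (All (_< N)) T →
  part (incAt j (map length T)) (suc j) < part (incAt j (map length T)) j →
  inv (appendAt j N T) ≡ inv T
inv-appendAt-corner j       []      _       _           _       = refl
inv-appendAt-corner zero {N} (R ∷ T) (_ ∷ P) _          (s≤s c) =
  cong (_+ inv T) (invBelow-∷ʳ R N T (lengths≤ T P c))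
inv-appendAt-corner (suc j) (R ∷ T) (Q≤R ∷ P) (R<N ∷ T<N) c =
  cong₂ _+_ (invBelow-appendAt R j T R<N (≤-trans (part≤head P j) Q≤R)) (inv-appendAt-corner j T P T<N c)

invBelow-swapAt : ∀ R j T → invBelow R (swapAt j T) ≡ invBelow R T
invBelow-swapAt R zero    []          = refl
invBelow-swapAt R zero    (_ ∷ [])    = refl
invBelow-swapAt R zero    (P ∷ Q ∷ T) = +-swap (rowInv R Q) (rowInv R P) (invBelow R T)
  where
  +-swap : ∀ a b c → a + (b + c) ≡ b + (a + c)
  +-swap a b c = trans (sym (+-assoc a b c)) (trans (cong (_+ c) (+-comm a b)) (+-assoc b a c))
invBelow-swapAt R (suc j) []          = refl
invBelow-swapAt R (suc j) (Q ∷ T)     = cong (rowInv R Q +_) (invBelow-swapAt R j T)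

Unique-++-disjoint : ∀ R {Q : List ℕ} → Unique (R ++ Q) → ∀ {x} → x ∈ R → x ∉ Q
Unique-++-disjoint (x ∷ R) (x≢ ∷ _) (here refl) x∈Q = All.lookup (All.++⁻ʳ R x≢) x∈Q refl
Unique-++-disjoint (_ ∷ R) (_ ∷ u)  (there x∈R) x∈Q = Unique-++-disjoint R u x∈R x∈Q

Unique-++⁻ʳ : ∀ R {Q : List ℕ} → Unique (R ++ Q) → Unique Q
Unique-++⁻ʳ []      u       = u
Unique-++⁻ʳ (_ ∷ R) (_ ∷ u) = Unique-++⁻ʳ R u

-- Any third row lies above both exchanged rows or below both, before and after, so its total with
-- them is unchanged. Only the pair formed by the two rows matters, and `rowInv-swap` settles it.
inv-appendAt-flat : ∀ j {N} T → suc j < length T → All (All (_< N)) T → Unique (concat T) →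
  part (incAt j (map length T)) (suc j) ≡ part (incAt j (map length T)) j →
  inv (appendAt j N T) ≡ suc (inv (swapAt j (appendAt j N T)))
inv-appendAt-flat zero    (R ∷ [])    (s≤s ())
inv-appendAt-flat zero {N} (R ∷ Q ∷ T) _ (_ ∷ Q<N ∷ _) u eq = begin
  (rowInv (R ∷ʳ N) Q + invBelow (R ∷ʳ N) T) + (invBelow Q T + inv T)
    ≡⟨ cong (λ m → (m + invBelow (R ∷ʳ N) T) + (invBelow Q T + inv T)) (rowInv-swap R Q eq Q<N
         (λ x∈R x∈Q → Unique-++-disjoint R u x∈R (∈-++⁺ˡ x∈Q))) ⟩
  suc ((rowInv Q (R ∷ʳ N) + invBelow (R ∷ʳ N) T) + (invBelow Q T + inv T))
    ≡⟨ cong suc (+-interchange (rowInv Q (R ∷ʳ N)) (invBelow (R ∷ʳ N) T) (invBelow Q T) (inv T)) ⟩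
  suc ((rowInv Q (R ∷ʳ N) + invBelow Q T) + (invBelow (R ∷ʳ N) T + inv T)) ∎
  where
  open ≡-Reasoning
inv-appendAt-flat (suc j) {N} (R ∷ T) (s≤s j+1<m) (_ ∷ T<N) u eq = begin
  invBelow R (appendAt j N T) + inv (appendAt j N T)
    ≡⟨ cong₂ _+_ (sym (invBelow-swapAt R j (appendAt j N T)))
         (inv-appendAt-flat j T j+1<m T<N (Unique-++⁻ʳ R u) eq) ⟩
  invBelow R (swapAt j (appendAt j N T)) + suc (inv (swapAt j (appendAt j N T)))
    ≡⟨ +-suc _ _ ⟩
  suc (invBelow R (swapAt j (appendAt j N T)) + inv (swapAt j (appendAt j N T))) ∎
  where open ≡-Reasoning

-- Counting tableaux

module _ {P : Tab → Set} where

  card-⇔ : ∀ {Q n} → (∀ T → P T → Q T) → (∀ T → Q T → P T) → HasCard P n → HasCard Q n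
  card-⇔ f g (xs , u , ps , c , len) = xs , u , All.map (f _) ps , (λ T → c T ∘ g T) , len

  card-∅ : (∀ T → ¬ P T) → HasCard P 0
  card-∅ ¬P = [] , [] , [] , (λ T p → contradiction p (¬P T)) , refl

  card-⊎ : ∀ {Q m n} → (∀ T → P T → ¬ Q T) → HasCard P m → HasCard Q n → HasCard (λ T → P T ⊎ Q T) (m + n)
  card-⊎ {Q} disj (xs , u , ps , c , len) (ys , v , qs , e , len′) =
    xs ++ ys ,
    Unique.++⁺ u v (λ { (z∈xs , z∈ys) → disj _ (All.lookup ps z∈xs) (All.lookup qs z∈ys) }) ,
    All.++⁺ (All.map inj₁ ps) (All.map inj₂ qs) ,
    complete ,
    trans (length-++ xs) (cong₂ _+_ len len′)
    where
    complete : ∀ T → P T ⊎ Q T → T ∈ xs ++ ys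
    complete T (inj₁ p) = ∈-++⁺ˡ (c T p)
    complete T (inj₂ q) = ∈-++⁺ʳ xs (e T q)

  card-image : ∀ (φ : Tab → Tab) {n} → (∀ T U → P T → P U → φ T ≡ φ U → T ≡ U) →
    HasCard P n → HasCard (λ U → ∃ λ T → P T × U ≡ φ T) n
  card-image φ inj (xs , u , ps , c , len) =
    map φ xs , unique u ps ,
    All.map⁺ (All.map (λ {T} p → T , p , refl) ps) ,
    (λ { U (T , p , refl) → ∈-map⁺ φ (c T p) }) ,
    trans (length-map φ xs) len
    where
    unique : ∀ {ys} → Unique ys → All P ys → Unique (map φ ys)
    unique []       []       = []
    unique (y∉ ∷ v) (p ∷ qs) =
      All.map⁺ (All.map (λ { (y≢z , q) eq → y≢z (inj _ _ p q eq) }) (All.zip (y∉ , qs))) ∷ unique v qs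

  card-unique : ∀ {m n} → HasCard P m → HasCard P n → m ≡ n
  card-unique (xs , u , ps , c , refl) (ys , v , qs , e , refl) =
    ↭-length (∼bag⇒↭ (unique∧set⇒bag u v
      (mk⇔ (λ z∈xs → e _ (All.lookup ps z∈xs)) (λ z∈ys → c _ (All.lookup qs z∈ys)))))

card-∑ : ∀ n {P : ℕ → Tab → Set} {c} → (∀ i j T → P i T → P j T → i ≡ j) →
  (∀ j → HasCard (P j) (c j)) → HasCard (λ T → ∃ λ j → j < n × P j T) (∑ n c)
card-∑ zero    _    _  = card-∅ λ { _ (_ , () , _) }
card-∑ (suc n) {P} {c} disj cs =
  card-⇔ {λ T → P 0 T ⊎ ∃ λ j → j < n × P (suc j) T} merge split
    (card-⊎ (λ { T p (j , _ , q) → contradiction (disj 0 (suc j) T p q) λ () })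
      (cs 0) (card-∑ n (λ i j T p q → suc-injective (disj (suc i) (suc j) T p q)) (cs ∘ suc)))
  where
  merge : ∀ T → P 0 T ⊎ (∃ λ j → j < n × P (suc j) T) → ∃ λ j → j < suc n × P j T
  merge T (inj₁ p)             = 0 , z<s , p
  merge T (inj₂ (j , j<n , p)) = suc j , s<s j<n , p
  split : ∀ T → (∃ λ j → j < suc n × P j T) → P 0 T ⊎ (∃ λ j → j < n × P (suc j) T)
  split T (zero  , _       , p) = inj₁ p
  split T (suc j , s≤s j<n , p) = inj₂ (j , j<n , p)

oneTo-suc : ∀ n → oneTo (suc n) ↭ suc n ∷ oneTo n
oneTo-suc n = ↭-trans
  (↭-reflexive (trans (cong (map suc) (sym (upTo-∷ʳ n))) (map-++ suc (upTo n) [ n ])))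
  (↭-sym (∷↭∷ʳ (suc n) (oneTo n)))

oneTo-< : ∀ n → All (_< suc n) (oneTo n)
oneTo-< n = All.map⁺ (All.tabulate (s<s ∘ ∈-upTo⁻))

oneTo-unique : ∀ n → Unique (oneTo n)
oneTo-unique n = Unique.map⁺ suc-injective (Unique.upTo⁺ n)

length-incAt : ∀ j μ → length (incAt j μ) ≡ length μ
length-incAt j       []      = refl
length-incAt zero    (y ∷ μ) = refl
length-incAt (suc j) (y ∷ μ) = cong suc (length-incAt j μ)

decAt-incAt : ∀ j μ → decAt j (incAt j μ) ≡ μ
decAt-incAt j       []      = refl
decAt-incAt zero    (y ∷ μ) = refl
decAt-incAt (suc j) (y ∷ μ) = cong (y ∷_) (decAt-incAt j μ)

incAt-decAt : ∀ j μ → 0 < part μ j → incAt j (decAt j μ) ≡ μ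
incAt-decAt zero    (suc y ∷ μ) _ = refl
incAt-decAt (suc j) (y ∷ μ)     p = cong (y ∷_) (incAt-decAt j μ p)

part-incAt-pos : ∀ j μ → j < length μ → 0 < part (incAt j μ) j
part-incAt-pos zero    (y ∷ μ) _         = z<s
part-incAt-pos (suc j) (y ∷ μ) (s≤s j<m) = part-incAt-pos j μ j<m

part-beyond : ∀ μ → part μ (length μ) ≡ 0
part-beyond []      = refl
part-beyond (_ ∷ μ) = part-beyond μ

part-pos⇒< : ∀ j μ → 0 < part μ j → j < length μ
part-pos⇒< zero    (y ∷ μ) _ = z<s
part-pos⇒< (suc j) (y ∷ μ) p = s<s (part-pos⇒< j μ p)

part-antitone : ∀ {μ} → Partition μ → ∀ j → part μ (suc j) ≤ part μ j
part-antitone []        j       = z≤n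
part-antitone (z≤y ∷ P) zero    = z≤y
part-antitone (z≤y ∷ P) (suc j) = part-antitone P j

-- What is left after deleting `suc n` from row `j`. Row `j` need not be a corner, so the remaining
-- lengths may fail to decrease; stating the shape through `incAt` covers this case and avoids
-- truncated subtraction.
record Trimmed (n : ℕ) (μ : Shape) (j : ℕ) (T : Tab) : Set where
  constructor trimmed
  field
    entries     : concat T ↭ oneTo n
    rowStandard : RowStandard T
    shape       : incAt j (map length T) ≡ μ
    inside      : j < length T

  bounded : All (All (_< suc n)) T
  bounded = All.concat⁻ (All-resp-↭ (↭-sym entries) (oneTo-< n))

  fresh : suc n ∉ concat T
  fresh N∈T = <-irrefl refl (All.lookup (oneTo-< n) (∈-resp-↭ entries N∈T))

  distinct : Unique (concat T)
  distinct = ↭ₛ.Unique-resp-↭ (setoid ℕ) (↭⇒↭ₛ (↭-sym entries)) (oneTo-unique n)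

  inside-shape : j < length μ
  inside-shape = subst (j <_)
    (trans (sym (length-map length T)) (trans (sym (length-incAt j (map length T))) (cong length shape))) inside

  nonempty : 0 < part μ j
  nonempty = subst (λ ν → 0 < part ν j) shape
    (part-incAt-pos j (map length T) (subst (j <_) (sym (length-map length T)) inside))

open Trimmed

AtRow : ℕ → ℕ → Shape → ℕ → Tab → Set
AtRow k n μ j T = ∃ λ U → Trimmed n μ j U × inv T ≡ k × T ≡ appendAt j (suc n) U

module _ {k n : ℕ} {μ : Shape} (Σμ : sum μ ≡ suc n) where

  S⇒AtRow : ∀ T → S k μ T → ∃ λ j → j < length μ × AtRow k n μ j T
  S⇒AtRow T ((shape-T , entries-T) , rows , inv-T)
    with entries-T′ ← ↭-trans (subst (λ m → concat T ↭ oneTo m) Σμ entries-T) (oneTo-suc n)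
    with remove-max rows
           (All-resp-↭ (↭-sym entries-T′) (≤-refl ∷ All.map <⇒≤ (oneTo-< n)))
           (∈-resp-↭ (↭-sym entries-T′) (here refl))
  ... | j , U , j<m , refl =
    j , inside-shape U-trimmed , U , U-trimmed , trans (sym (inversions-inv T)) inv-T , refl
    where
    U-trimmed : Trimmed n μ j U
    U-trimmed = trimmed
      (drop-∷ (↭-trans (↭-sym (concat-appendAt j (suc n) U j<m)) entries-T′))
      (appendAt-rowStandard⁻ j U rows)
      (trans (sym (map-length-appendAt j (suc n) U)) shape-T)
      j<m

  AtRow⇒S : ∀ T → (∃ λ j → j < length μ × AtRow k n μ j T) → S k μ T
  AtRow⇒S T (j , _ , U , t , inv-T , refl) =
    ( trans (map-length-appendAt j (suc n) U) (shape t)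
    , subst (λ m → concat T ↭ oneTo m) (sym Σμ)
        (↭-trans (concat-appendAt j (suc n) U (inside t))
          (↭-trans (↭-prep (suc n) (entries t)) (↭-sym (oneTo-suc n)))) )
    , appendAt-rowStandard⁺ j (rowStandard t) (bounded t)
    , trans (inversions-inv T) inv-T

AtRow-disjoint : ∀ {k n μ} i j T → AtRow k n μ i T → AtRow k n μ j T → i ≡ j
AtRow-disjoint i j T (U , t , _ , eq) (V , t′ , _ , eq′) =
  proj₁ (appendAt-injective i j U V (fresh t) (fresh t′) (inside t) (inside t′) (trans (sym eq) eq′))

module _ {n : ℕ} {μ : Shape} {j : ℕ} (P : Partition μ) (Σμ : sum μ ≡ suc n) (c : part μ (suc j) < part μ j) where

  private
    j-pos : 0 < part μ j
    j-pos = ≤-<-trans z≤n c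

    sum-dec : sum (decAt j μ) ≡ n
    sum-dec = suc-injective (trans (sum-decAt j μ j-pos) Σμ)

    S⇒Trimmed : ∀ {k U} → S k (decAt j μ) U → Trimmed n μ j U
    S⇒Trimmed {k} {U} ((shape-U , entries-U) , rows , _) = trimmed
      (subst (λ m → concat U ↭ oneTo m) sum-dec entries-U) rows shape′
      (subst (j <_) (trans (cong length (sym shape′))
        (trans (length-incAt j (map length U)) (length-map length U))) (part-pos⇒< j μ j-pos))
      where
      shape′ : incAt j (map length U) ≡ μ
      shape′ = trans (cong (incAt j) shape-U) (incAt-decAt j μ j-pos)

    inv-append : ∀ {U} → Trimmed n μ j U → inv (appendAt j (suc n) U) ≡ inv U
    inv-append {U} t = inv-appendAt-corner j U (subst Partition (sym (shape t)) P) (bounded t)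
      (subst (λ ν → part ν (suc j) < part ν j) (sym (shape t)) c)

  card-corner : ∀ {k m} → HasCard (S k (decAt j μ)) m → HasCard (AtRow k n μ j) m
  card-corner {k} = card-⇔ {λ T → ∃ λ U → S k (decAt j μ) U × T ≡ appendAt j (suc n) U} to from
    ∘ card-image (appendAt j (suc n)) λ U V s s′ eq →
        let t = S⇒Trimmed s ; t′ = S⇒Trimmed s′ in
        proj₂ (appendAt-injective j j U V (fresh t) (fresh t′) (inside t) (inside t′) eq)
    where
    to : ∀ T → (∃ λ U → S k (decAt j μ) U × T ≡ appendAt j (suc n) U) → AtRow k n μ j T
    to T (U , s@(_ , _ , inv-U) , refl) =
      U , t , trans (inv-append t) (trans (sym (inversions-inv U)) inv-U) , refl
      where
      t : Trimmed n μ j U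
      t = S⇒Trimmed s
    from : ∀ T → AtRow k n μ j T → ∃ λ U → S k (decAt j μ) U × T ≡ appendAt j (suc n) U
    from T (U , t , inv-T , refl) = U ,
      ( ( trans (sym (decAt-incAt j (map length U))) (cong (decAt j) (shape t))
        , subst (λ m → concat U ↭ oneTo m) (sym sum-dec) (entries t) )
      , rowStandard t
      , trans (inversions-inv U) (trans (sym (inv-append t)) inv-T) )
      , refl

incAt-swapAt⁺ : ∀ j T → suc j < length T →
  part (incAt j (map length T)) (suc j) ≡ part (incAt j (map length T)) j →
  incAt (suc j) (map length (swapAt j T)) ≡ incAt j (map length T)
incAt-swapAt⁺ zero    (R ∷ [])    (s≤s ())
incAt-swapAt⁺ zero    (R ∷ Q ∷ T) _           eq = cong₂ _∷_ eq (cong (_∷ map length T) (sym eq))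
incAt-swapAt⁺ (suc j) (R ∷ T)     (s≤s j+1<m) eq = cong (length R ∷_) (incAt-swapAt⁺ j T j+1<m eq)

incAt-swapAt⁻ : ∀ j T → suc j < length T →
  part (incAt (suc j) (map length T)) (suc j) ≡ part (incAt (suc j) (map length T)) j →
  incAt j (map length (swapAt j T)) ≡ incAt (suc j) (map length T)
incAt-swapAt⁻ zero    (R ∷ [])    (s≤s ())
incAt-swapAt⁻ zero    (R ∷ Q ∷ T) _           eq = cong₂ _∷_ eq (cong (_∷ map length T) (sym eq))
incAt-swapAt⁻ (suc j) (R ∷ T)     (s≤s j+1<m) eq = cong (length R ∷_) (incAt-swapAt⁻ j T j+1<m eq)

module _ {n : ℕ} {μ : Shape} {j : ℕ} (flat : part μ (suc j) ≡ part μ j) where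

  private
    N : ℕ
    N = suc n

    length-swap : ∀ T → length T ≡ length (swapAt j T)
    length-swap T = sym (↭-length (swapAt-↭ j T))

    swap-rows : ∀ {T} → RowStandard T → RowStandard (swapAt j T)
    swap-rows {T} = All-resp-↭ (↭-sym (swapAt-↭ j T))

    next-inside : ∀ {U} → Trimmed n μ j U → suc j < length U
    next-inside {U} t = subst (suc j <_)
      (trans (cong length (sym (shape t))) (trans (length-incAt j (map length U)) (length-map length U)))
      (part-pos⇒< (suc j) μ (subst (0 <_) (sym flat) (nonempty t)))

    down : ∀ {U} → Trimmed n μ j U → Trimmed n μ (suc j) (swapAt j U)
    down {U} t = trimmed
      (↭-trans (concat-swapAt j U) (entries t)) (swap-rows (rowStandard t))
      (trans (incAt-swapAt⁺ j U (next-inside t)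
        (subst (λ ν → part ν (suc j) ≡ part ν j) (sym (shape t)) flat)) (shape t))
      (subst (suc j <_) (length-swap U) (next-inside t))

    up : ∀ {U} → Trimmed n μ (suc j) U → Trimmed n μ j (swapAt j U)
    up {U} t = trimmed
      (↭-trans (concat-swapAt j U) (entries t)) (swap-rows (rowStandard t))
      (trans (incAt-swapAt⁻ j U (inside t)
        (subst (λ ν → part ν (suc j) ≡ part ν j) (sym (shape t)) flat)) (shape t))
      (subst (j <_) (length-swap U) (<-trans (n<1+n j) (inside t)))

    inv-swap : ∀ {U} → Trimmed n μ j U → inv (appendAt j N U) ≡ suc (inv (swapAt j (appendAt j N U)))
    inv-swap {U} t = inv-appendAt-flat j U (next-inside t) (bounded t) (distinct t)
      (subst (λ ν → part ν (suc j) ≡ part ν j) (sym (shape t)) flat)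

  card-flat₀ : HasCard (AtRow 0 n μ j) 0
  card-flat₀ = card-∅ λ { T (U , t , inv-T , refl) → contradiction (trans (sym inv-T) (inv-swap t)) λ () }

  -- The exchange of rows is an involution, and only the equality of the two lengths enters. Whether
  -- row `j + 1` is a corner is left to the count supplied for it.
  card-flat : ∀ {k m} → HasCard (AtRow k n μ (suc j)) m → HasCard (AtRow (suc k) n μ j) m
  card-flat {k} = card-⇔ {λ T → ∃ λ V → AtRow k n μ (suc j) V × T ≡ swapAt j V} to from
    ∘ card-image (swapAt j) λ T V _ _ eq →
        trans (sym (swapAt-swapAt j T)) (trans (cong (swapAt j) eq) (swapAt-swapAt j V))
    where
    to : ∀ T → (∃ λ V → AtRow k n μ (suc j) V × T ≡ swapAt j V) → AtRow (suc k) n μ j T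
    to T (V , (U , t , inv-V , refl) , refl) = swapAt j U , up t ,
      trans (cong inv (sym append-swap))
        (trans (inv-swap (up t)) (cong suc (trans (cong inv swap-append) inv-V))) ,
      sym append-swap
      where
      swap-append : swapAt j (appendAt j N (swapAt j U)) ≡ appendAt (suc j) N U
      swap-append = trans (swapAt-appendAt j N (swapAt j U) (next-inside (up t)))
        (cong (appendAt (suc j) N) (swapAt-swapAt j U))
      append-swap : appendAt j N (swapAt j U) ≡ swapAt j (appendAt (suc j) N U)
      append-swap = trans (sym (swapAt-swapAt j _)) (cong (swapAt j) swap-append)
    from : ∀ T → AtRow (suc k) n μ j T → ∃ λ V → AtRow k n μ (suc j) V × T ≡ swapAt j V
    from T (U , t , inv-T , refl) = swapAt j T ,
      (swapAt j U , down t , suc-injective (trans (sym (inv-swap t)) inv-T) ,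
        swapAt-appendAt j N U (next-inside t)) ,
      sym (swapAt-swapAt j T)

-- The two recursions for numbers of tableaux

emptyTab : Shape → Tab
emptyTab = map (λ _ → [])

map-length-empty : ∀ μ → sum μ ≡ 0 → map length (emptyTab μ) ≡ μ
map-length-empty []         _ = refl
map-length-empty (zero ∷ μ) e = cong (0 ∷_) (map-length-empty μ e)

empty-unique : ∀ T → sum (map length T) ≡ 0 → T ≡ emptyTab (map length T)
empty-unique []       _ = refl
empty-unique ([] ∷ T) e = cong ([] ∷_) (empty-unique T e)

concat-empty : ∀ μ → concat (emptyTab μ) ≡ []
concat-empty []      = refl
concat-empty (_ ∷ μ) = concat-empty μ

empty-rowStandard : ∀ μ → RowStandard (emptyTab μ)
empty-rowStandard []      = []
empty-rowStandard (_ ∷ μ) = [] ∷ empty-rowStandard μ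

inv-empty : ∀ μ → inv (emptyTab μ) ≡ 0
inv-empty []      = refl
inv-empty (_ ∷ μ) = cong₂ _+_ (below (emptyTab μ)) (inv-empty μ)
  where
  below : ∀ T → invBelow [] T ≡ 0
  below []      = refl
  below (_ ∷ T) = below T

S-empty : ∀ {k} {μ T} → sum μ ≡ 0 → S k μ T → T ≡ emptyTab μ × k ≡ 0
S-empty {k} {μ} {T} Σμ ((refl , _) , _ , inv-T) = T≡ ,
  trans (sym inv-T) (trans (inversions-inv T) (trans (cong inv T≡) (inv-empty μ)))
  where
  T≡ : T ≡ emptyTab μ
  T≡ = empty-unique T Σμ

card-S₀ : ∀ n {μ} → Partition μ → sum μ ≡ n → HasCard (S 0 μ) (count₀ n μ)
card-row₀ : ∀ n {μ} → Partition μ → sum μ ≡ suc n → ∀ j →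
  HasCard (AtRow 0 n μ j) (guard (corner? μ j) (count₀ n (decAt j μ)))

card-S₀ zero {μ} P Σμ = emptyTab μ ∷ [] , [] ∷ [] , s ∷ [] , (λ T s′ → here (proj₁ (S-empty Σμ s′))) , refl
  where
  s : S 0 μ (emptyTab μ)
  s = (map-length-empty μ Σμ , ↭-reflexive (trans (concat-empty μ) (cong oneTo (sym Σμ)))) ,
      empty-rowStandard μ , trans (inversions-inv (emptyTab μ)) (inv-empty μ)
card-S₀ (suc n) {μ} P Σμ = card-⇔ (AtRow⇒S Σμ) (S⇒AtRow Σμ)
  (card-∑ (length μ) AtRow-disjoint (card-row₀ n P Σμ))

card-row₀ n {μ} P Σμ j = split (corner? μ j)
  where
  split : (d : Dec (part μ (suc j) < part μ j)) → HasCard (AtRow 0 n μ j) (guard d (count₀ n (decAt j μ)))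
  split (yes c) = card-corner P Σμ c (card-S₀ n (decAt-partition j P c)
    (suc-injective (trans (sum-decAt j μ (≤-<-trans z≤n c)) Σμ)))
  split (no ¬c) = card-flat₀ (≤-antisym (part-antitone P j) (≮⇒≥ ¬c))

∑-last : ∀ n f → ∑ (suc n) f ≡ ∑ n f + f n
∑-last zero    f = +-identityʳ (f 0)
∑-last (suc n) f = trans (cong (f 0 +_) (∑-last n (f ∘ suc))) (sym (+-assoc (f 0) _ _))

-- A row `j` as long as the next one contributes the term of row `j + 1`. The shift costs nothing:
-- term 0 vanishes because the bound exceeds the first row, term `length μ` because there is no
-- corner past the last row.
repeatedSum-shift : ∀ g μ →
  ∑ (length μ) (repeatedTerm (suc (part μ 0)) g μ ∘ suc) ≡ repeatedSum (suc (part μ 0)) g μ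
repeatedSum-shift g μ = begin
  ∑ m (t ∘ suc)       ≡⟨ cong (_+ ∑ m (t ∘ suc)) (guard-no (part μ 0 ≟ suc (part μ 0)) (<⇒≢ ≤-refl)) ⟨
  t 0 + ∑ m (t ∘ suc) ≡⟨ ∑-last m t ⟩
  ∑ m t + t m         ≡⟨ cong (∑ m t +_) t-m ⟩
  ∑ m t + 0           ≡⟨ +-identityʳ (∑ m t) ⟩
  ∑ m t               ∎
  where
  open ≡-Reasoning
  m : ℕ
  m = length μ
  t : ℕ → ℕ
  t = repeatedTerm (suc (part μ 0)) g μ
  t-m : t m ≡ 0
  t-m = trans
    (cong (guard (part μ m ≟ part (suc (part μ 0) ∷ μ) m))
      (guard-no (corner? μ m) λ c → contradiction (<-≤-trans c (≤-reflexive (part-beyond μ))) λ ()))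
    (guard-0 (part μ m ≟ part (suc (part μ 0) ∷ μ) m))

-- In each row at most one of the two summands of `card-row₁` survives: a corner at `j` excludes the
-- equality of lengths in the repeated term of `j + 1`. Without a corner the exchange leads to
-- `card-row₀` at `j + 1`, whose corner guard is the second guard of `repeatedTerm`.
card-S₁ : ∀ n {μ} → Partition μ → sum μ ≡ n → HasCard (S 1 μ) (count₁ n μ)
card-row₁ : ∀ n {μ} → Partition μ → sum μ ≡ suc n → ∀ j → HasCard (AtRow 1 n μ j)
  (guard (corner? μ j) (count₁ n (decAt j μ)) + repeatedTerm (suc (part μ 0)) (count₀ n) μ (suc j))

card-S₁ zero    P Σμ = card-∅ λ T s → contradiction (proj₂ (S-empty Σμ s)) λ ()
card-S₁ (suc n) {μ} P Σμ = subst (HasCard (S 1 μ))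
  (trans (∑-+ (length μ) (λ j → guard (corner? μ j) (count₁ n (decAt j μ)))
      (repeatedTerm (suc (part μ 0)) (count₀ n) μ ∘ suc))
    (cong (removeSum (count₁ n) μ +_) (repeatedSum-shift (count₀ n) μ)))
  (card-⇔ (AtRow⇒S Σμ) (S⇒AtRow Σμ) (card-∑ (length μ) AtRow-disjoint (card-row₁ n P Σμ)))

card-row₁ n {μ} P Σμ j = split (corner? μ j)
  where
  t : ℕ
  t = repeatedTerm (suc (part μ 0)) (count₀ n) μ (suc j)
  split : (d : Dec (part μ (suc j) < part μ j)) → HasCard (AtRow 1 n μ j) (guard d (count₁ n (decAt j μ)) + t)
  split (yes c) = subst (HasCard (AtRow 1 n μ j))
    (sym (trans (cong (count₁ n (decAt j μ) +_) (guard-no (part μ (suc j) ≟ part μ j) (<⇒≢ c))) (+-identityʳ _)))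
    (card-corner P Σμ c (card-S₁ n (decAt-partition j P c)
      (suc-injective (trans (sum-decAt j μ (≤-<-trans z≤n c)) Σμ))))
  split (no ¬c) = subst (HasCard (AtRow 1 n μ j)) (sym (guard-yes (part μ (suc j) ≟ part μ j) flat))
    (card-flat flat (card-row₀ n P Σμ (suc j)))
    where
    flat : part μ (suc j) ≡ part μ j
    flat = ≤-antisym (part-antitone P j) (≮⇒≥ ¬c)

partition : ∀ {μ} → Linked _≥_ μ → Partition μ
partition []        = []
partition [-]       = z≤n ∷ []
partition (y≥z ∷ l) = y≥z ∷ partition l

theorem3p2 : (λs : List ℕ) → λs ≢ [] → Linked _≥_ λs → All (0 <_) λs →
    (f : ℕ → ℕ → ℕ) →
    (∀ i₁ i₂ → ValidE λs i₁ i₂ → HasCard (S 0 (shapeE λs i₁ i₂)) (f i₁ i₂)) →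
    HasCard (S 1 λs) (sumE λs f)
theorem3p2 λs _ sorted _ f cards = subst (HasCard (S 1 λs))
  -- Each `≤-refl` used as a bound chooses `suc (part λs 0)` for λ₀ = ∞.
  (sym (trans (sumE-moveSum λs f (count₀ n) ≤-refl f-count₀) (moveSum-count₀ n P refl ≤-refl)))
  (card-S₁ n P refl)
  where
  n : ℕ
  n = sum λs
  P : Partition λs
  P = partition sorted

  f-count₀ : ∀ a b → a < b → ValidE λs (suc b) (suc a) → f (suc b) (suc a) ≡ count₀ n (decAt b (incAt a λs))
  -- `f` is known only through `HasCard`, on the shape without zero rows, so uniqueness of
  -- cardinalities identifies its value. Row `b` may have lost its only box, hence the passage back
  -- through `count₀-dropZeros`.
  f-count₀ a b a<b v = trans
    (card-unique (cards (suc b) (suc a) v)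
      (subst (λ ν → HasCard (S 0 (dropZeros ν)) (count₀ n (dropZeros μ))) (sym (addEAt-move 1 λs a<b))
        (card-S₀ n (dropZeros-partition Q) (trans (sum-dropZeros μ) sum-μ))))
    (count₀-dropZeros n Q)
    where
    μ : Shape
    μ = decAt b (incAt a λs)
    b-corner : part (incAt a λs) (suc b) < part (incAt a λs) b
    b-corner = subst₂ _<_ (sym (part-incAt-> λs (m<n⇒m<1+n a<b))) (sym (part-incAt-> λs a<b))
      (validE⇒corner λs {a} {b} ≤-refl v)
    Q : Partition μ
    Q = decAt-partition b (proj₁ (incAt-partition a P (n≤1+n _) (validE⇒addable λs {a} {b} ≤-refl v))) b-corner
    sum-μ : sum μ ≡ n
    sum-μ = suc-injective (trans (sum-decAt b (incAt a λs) (≤-<-trans z≤n b-corner))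
      (sum-incAt a λs (<-trans a<b (proj₁ (proj₂ (proj₂ v))))))
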